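{- Let $I_n$ denote the number of unlabeled interval graphs on $n$ vertices. Then $\log I_n \sim n\log n$ as $n\to\infty$, i.e. $$\lim_{n\to\infty}\frac{\log I_n}{n\log n}=1.$$
   Context: A simple undirected graph is an interval graph if it is isomorphic to the intersection graph of a family of intervals on the real line: the vertices correspond to the intervals of the family, and two distinct vertices are adjacent if and only if the corresponding intervals have nonempty intersection. The number $I_n$ of unlabeled interval graphs on $n$ vertices is the number of isomorphism classes of interval graphs with exactly $n$ vertices. Here $\log$ is the natural logarithm. -}

module Defs where

open import Level using (0ℓ) renaming (suc to lsuc)
open import Data.Nat.Base as ℕ using (ℕ; zero; suc)
import Data.Nat.Properties as ℕₚ
open import Data.Integer.Base as ℤ using (+_)
import Data.Integer.Properties as ℤₚ
open import Data.Rational.Base as ℚ using (ℚ; 0ℚ; 1ℚ; ½; toℚᵘ)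
import Data.Rational.Properties as ℚₚ
open import Data.Rational.Solver using (module +-*-Solver)
open import Data.Rational.Unnormalised.Base as ℚᵘ using (mkℚᵘ)
import Data.Rational.Unnormalised.Properties as ℚᵘₚ
open import Data.Fin.Base using (Fin)
import Data.Fin.Properties as Finₚ
open import Data.Product using (Σ; Σ-syntax; ∃; ∃-syntax; _×_; _,_; proj₁; proj₂)
open import Data.Sum.Base using (inj₁; inj₂)
open import Function.Base using (_∘_)
open import Function.Bundles using (_↔_; _⇔_; mk⇔; Inverse; Equivalence; Bijection; Injection)
open import Function.Properties.Inverse using (↔-refl; ↔-sym; ↔-trans)
open import Relation.Binary.Bundles using (Setoid)
open import Relation.Binary.Core using (Rel)
open import Relation.Binary.Definitions using (Decidable; Symmetric; Irreflexive)
open import Relation.Binary.PropositionalEquality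
  using (_≡_; _≢_; refl; sym; trans; cong; cong₂; subst; subst₂; setoid; module ≡-Reasoning)
open import Relation.Nullary using (yes; no; contradiction)

private
  infixl 6 _+_ _-_
  infixl 7 _*_
  _+_ _-_ _*_ : ℚ → ℚ → ℚ
  _+_ = ℚ._+_
  _-_ = ℚ._-_
  _*_ = ℚ._*_

  module QR = ℚₚ.≤-Reasoning

module RationalLemmas where

  0<½* : ∀ {ε} → 0ℚ ℚ.< ε → 0ℚ ℚ.< ε * ½
  0<½* {ε} 0<ε = ℚₚ.positive⁻¹ (ε * ½)
    {{ℚₚ.pos*pos⇒pos ε {{ℚ.positive 0<ε}} ½}}

  halves : ∀ ε → ε * ½ + ε * ½ ≡ ε
  halves ε = trans (sym (ℚₚ.*-distribˡ-+ ε ½ ½)) (ℚₚ.*-identityʳ ε)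

  0<* : ∀ {p q} → 0ℚ ℚ.< p → 0ℚ ℚ.< q → 0ℚ ℚ.< p * q
  0<* {p} {q} 0<p 0<q = ℚₚ.positive⁻¹ (p * q)
    {{ℚₚ.pos*pos⇒pos p {{ℚ.positive 0<p}} q {{ℚ.positive 0<q}}}}

  *-mono-≤ : ∀ {p q r s} → 0ℚ ℚ.≤ p → 0ℚ ℚ.≤ s → p ℚ.≤ q → r ℚ.≤ s → p * r ℚ.≤ q * s
  *-mono-≤ {p} {q} {r} {s} 0≤p 0≤s p≤q r≤s =
    ℚₚ.≤-trans (ℚₚ.*-monoˡ-≤-nonNeg p {{ℚ.nonNegative 0≤p}} r≤s)
               (ℚₚ.*-monoʳ-≤-nonNeg s {{ℚ.nonNegative 0≤s}} p≤q)

  ∣∣≤ : ∀ {p q} → p ℚ.≤ q → ℚ.- p ℚ.≤ q → ℚ.∣ p ∣ ℚ.≤ q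
  ∣∣≤ {p} p≤q -p≤q with ℚₚ.∣p∣≡p∨∣p∣≡-p p
  ... | inj₁ e = subst (ℚ._≤ _) (sym e) p≤q
  ... | inj₂ e = subst (ℚ._≤ _) (sym e) -p≤q

  ≤+⇒-≤ : ∀ {p q r} → p ℚ.≤ r + q → p - q ℚ.≤ r
  ≤+⇒-≤ {p} {q} {r} p≤ = subst (p - q ℚ.≤_)
    (solve 2 (λ r q → r :+ q :- q := r) refl r q)
    (ℚₚ.+-monoˡ-≤ (ℚ.- q) p≤)
    where open +-*-Solver

  ∣-∣-sym : ∀ p q → ℚ.∣ p - q ∣ ≡ ℚ.∣ q - p ∣
  ∣-∣-sym p q = trans (sym (ℚₚ.∣-p∣≡∣p∣ (p - q)))
    (cong ℚ.∣_∣ (solve 2 (λ p q → :- (p :- q) := q :- p) refl p q))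
    where open +-*-Solver

  ∣p∣≤∣p-q∣+∣q∣ : ∀ p q → ℚ.∣ p ∣ ℚ.≤ ℚ.∣ p - q ∣ + ℚ.∣ q ∣
  ∣p∣≤∣p-q∣+∣q∣ p q = subst (λ z → ℚ.∣ z ∣ ℚ.≤ ℚ.∣ p - q ∣ + ℚ.∣ q ∣)
    (solve 2 (λ p q → p :- q :+ q := p) refl p q) (ℚₚ.∣p+q∣≤∣p∣+∣q∣ (p - q) q)
    where open +-*-Solver

  ∣∣p∣-∣q∣∣≤∣p-q∣ : ∀ p q → ℚ.∣ ℚ.∣ p ∣ - ℚ.∣ q ∣ ∣ ℚ.≤ ℚ.∣ p - q ∣
  ∣∣p∣-∣q∣∣≤∣p-q∣ p q = ∣∣≤ (≤+⇒-≤ (∣p∣≤∣p-q∣+∣q∣ p q))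
    (subst₂ ℚ._≤_ (solve 2 (λ a b → b :- a := :- (a :- b)) refl ℚ.∣ p ∣ ℚ.∣ q ∣) (∣-∣-sym q p)
      (≤+⇒-≤ (∣p∣≤∣p-q∣+∣q∣ q p)))
    where open +-*-Solver

open RationalLemmas public

-- Real numbers as Cauchy sequences of rationals.  Equality of reals is
-- never needed below: everything is stated through _≤ᴿ_ and _<ᴿ_, which
-- depend only on the limits of the sequences.

IsCauchy : (ℕ → ℚ) → Set
IsCauchy x = ∀ ε → 0ℚ ℚ.< ε →
  ∃[ N ] ∀ m n → N ℕ.≤ m → N ℕ.≤ n → ℚ.∣ x m ℚ.- x n ∣ ℚ.< ε

record ℝ : Set where
  constructor mkℝ
  field
    seq    : ℕ → ℚ
    cauchy : IsCauchy seq

open ℝ public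

infix 4 _≤ᴿ_ _<ᴿ_

_≤ᴿ_ : Rel ℝ 0ℓ
x ≤ᴿ y = ∀ ε → 0ℚ ℚ.< ε → ∃[ N ] ∀ n → N ℕ.≤ n → seq x n ℚ.≤ seq y n ℚ.+ ε

_<ᴿ_ : Rel ℝ 0ℓ
x <ᴿ y = ∃[ ε ] 0ℚ ℚ.< ε × ∃[ N ] ∀ n → N ℕ.≤ n → seq x n ℚ.+ ε ℚ.≤ seq y n

module CauchyLemmas where

  +-cauchy : ∀ {x y} → IsCauchy x → IsCauchy y → IsCauchy (λ n → x n + y n)
  +-cauchy {x} {y} cx cy ε 0<ε with cx (ε * ½) (0<½* 0<ε) | cy (ε * ½) (0<½* 0<ε)
  ... | M , p | N , q = M ℕ.⊔ N , λ m n m≥ n≥ → let open QR in begin-strict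
    ℚ.∣ x m + y m - (x n + y n) ∣
      ≡⟨ cong ℚ.∣_∣ (solve 4 (λ a b c d → a :+ b :- (c :+ d) := (a :- c) :+ (b :- d)) refl
                        (x m) (y m) (x n) (y n)) ⟩
    ℚ.∣ (x m - x n) + (y m - y n) ∣      ≤⟨ ℚₚ.∣p+q∣≤∣p∣+∣q∣ (x m - x n) (y m - y n) ⟩
    ℚ.∣ x m - x n ∣ + ℚ.∣ y m - y n ∣
      <⟨ ℚₚ.+-mono-< (p m n (ℕₚ.m⊔n≤o⇒m≤o M N m≥) (ℕₚ.m⊔n≤o⇒m≤o M N n≥))
                     (q m n (ℕₚ.m⊔n≤o⇒n≤o M N m≥) (ℕₚ.m⊔n≤o⇒n≤o M N n≥)) ⟩
    ε * ½ + ε * ½                        ≡⟨ halves ε ⟩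
    ε                                    ∎
    where open +-*-Solver

  neg-cauchy : ∀ {x} → IsCauchy x → IsCauchy (λ n → ℚ.- x n)
  neg-cauchy {x} cx ε 0<ε with cx ε 0<ε
  ... | N , p = N , λ m n m≥ n≥ → subst (ℚ._< ε)
    (trans (sym (ℚₚ.∣-p∣≡∣p∣ (x m - x n)))
           (cong ℚ.∣_∣ (solve 2 (λ a b → :- (a :- b) := :- a :- (:- b)) refl (x m) (x n))))
    (p m n m≥ n≥)
    where open +-*-Solver

  abs-cauchy : ∀ {x} → IsCauchy x → IsCauchy (λ n → ℚ.∣ x n ∣)
  abs-cauchy {x} cx ε 0<ε with cx ε 0<ε
  ... | N , p = N , λ m n m≥ n≥ →
    ℚₚ.≤-<-trans (∣∣p∣-∣q∣∣≤∣p-q∣ (x m) (x n)) (p m n m≥ n≥)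

  const-cauchy : ∀ q → IsCauchy (λ _ → q)
  const-cauchy q ε 0<ε = 0 , λ _ _ _ _ →
    subst (λ z → ℚ.∣ z ∣ ℚ.< ε) (sym (ℚₚ.+-inverseʳ q)) 0<ε

  EvBounded : (ℕ → ℚ) → ℚ → Set
  EvBounded x B = ∃[ N ] ∀ n → N ℕ.≤ n → ℚ.∣ x n ∣ ℚ.≤ B

  bounded : ∀ {x} → IsCauchy x → ∃[ B ] 0ℚ ℚ.< B × EvBounded x B
  bounded {x} cx with cx 1ℚ (ℚₚ.positive⁻¹ 1ℚ)
  ... | N , p = 1ℚ + ℚ.∣ x N ∣
    , ℚₚ.+-mono-<-≤ (ℚₚ.positive⁻¹ 1ℚ) (ℚₚ.0≤∣p∣ (x N))
    , N , λ n n≥ → ℚₚ.≤-trans (∣p∣≤∣p-q∣+∣q∣ (x n) (x N))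
            (ℚₚ.+-monoˡ-≤ ℚ.∣ x N ∣ (ℚₚ.<⇒≤ (p n N n≥ ℕₚ.≤-refl)))

  shrink : ∀ ε B → 0ℚ ℚ.< ε → 0ℚ ℚ.< B → ∃[ δ ] 0ℚ ℚ.< δ × B * δ ≡ ε
  shrink ε B 0<ε 0<B = B⁻¹ * ε , 0<* 0<B⁻¹ 0<ε
    , trans (sym (ℚₚ.*-assoc B B⁻¹ ε))
        (trans (cong (_* ε) (ℚₚ.*-inverseʳ B {{nz}})) (ℚₚ.*-identityˡ ε))
    where
    nz = ℚ.>-nonZero 0<B
    B⁻¹ = (ℚ.1/ B) {{nz}}
    0<B⁻¹ : 0ℚ ℚ.< B⁻¹
    0<B⁻¹ = ℚₚ.positive⁻¹ B⁻¹ {{ℚₚ.1/pos⇒pos B {{ℚ.positive 0<B}}}}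

  *-close : ∀ {a b c d B C δ γ} → 0ℚ ℚ.< B → 0ℚ ℚ.< C →
    ℚ.∣ a ∣ ℚ.≤ B → ℚ.∣ d ∣ ℚ.≤ C → ℚ.∣ b - d ∣ ℚ.< δ → ℚ.∣ a - c ∣ ℚ.< γ →
    ℚ.∣ a * b - c * d ∣ ℚ.< B * δ + C * γ
  *-close {a} {b} {c} {d} {B} {C} {δ} {γ} 0<B 0<C a≤B d≤C b~d a~c = let open QR in begin-strict
    ℚ.∣ a * b - c * d ∣
      ≡⟨ cong ℚ.∣_∣ (solve 4 (λ a b c d → a :* b :- c :* d := a :* (b :- d) :+ d :* (a :- c)) refl
                       a b c d) ⟩
    ℚ.∣ a * (b - d) + d * (a - c) ∣
      ≤⟨ ℚₚ.∣p+q∣≤∣p∣+∣q∣ (a * (b - d)) (d * (a - c)) ⟩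
    ℚ.∣ a * (b - d) ∣ + ℚ.∣ d * (a - c) ∣
      ≡⟨ cong₂ _+_ (ℚₚ.∣p*q∣≡∣p∣*∣q∣ a (b - d)) (ℚₚ.∣p*q∣≡∣p∣*∣q∣ d (a - c)) ⟩
    ℚ.∣ a ∣ * ℚ.∣ b - d ∣ + ℚ.∣ d ∣ * ℚ.∣ a - c ∣
      ≤⟨ ℚₚ.+-mono-≤
           (ℚₚ.*-monoʳ-≤-nonNeg ℚ.∣ b - d ∣ {{ℚₚ.∣-∣-nonNeg (b - d)}} a≤B)
           (ℚₚ.*-monoʳ-≤-nonNeg ℚ.∣ a - c ∣ {{ℚₚ.∣-∣-nonNeg (a - c)}} d≤C) ⟩
    B * ℚ.∣ b - d ∣ + C * ℚ.∣ a - c ∣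
      <⟨ ℚₚ.+-mono-< (ℚₚ.*-monoʳ-<-pos B {{ℚ.positive 0<B}} b~d)
                     (ℚₚ.*-monoʳ-<-pos C {{ℚ.positive 0<C}} a~c) ⟩
    B * δ + C * γ      ∎
    where open +-*-Solver

  *-cauchy : ∀ {x y} → IsCauchy x → IsCauchy y → IsCauchy (λ n → x n * y n)
  *-cauchy {x} {y} cx cy ε 0<ε = go (bounded cx) (bounded cy)
    where
    go : (∃[ B ] 0ℚ ℚ.< B × EvBounded x B) → (∃[ C ] 0ℚ ℚ.< C × EvBounded y C) →
      ∃[ N ] ∀ m n → N ℕ.≤ m → N ℕ.≤ n → ℚ.∣ x m ℚ.* y m ℚ.- x n ℚ.* y n ∣ ℚ.< ε
    go (B , 0<B , N₁ , b) (C , 0<C , N₂ , c) =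
      N , λ m n m≥ n≥ → subst (ℚ.∣ x m * y m - x n * y n ∣ ℚ.<_) total
        (*-close {x m} {y m} {x n} {y n} 0<B 0<C
          (b m (ℕₚ.m⊔n≤o⇒m≤o N₁ N₂ (i₁₂ m≥)))
          (c n (ℕₚ.m⊔n≤o⇒n≤o N₁ N₂ (i₁₂ n≥)))
          (proj₂ yN m n (ℕₚ.m⊔n≤o⇒m≤o N₃ N₄ (i₃₄ m≥)) (ℕₚ.m⊔n≤o⇒m≤o N₃ N₄ (i₃₄ n≥)))
          (proj₂ xN m n (ℕₚ.m⊔n≤o⇒n≤o N₃ N₄ (i₃₄ m≥)) (ℕₚ.m⊔n≤o⇒n≤o N₃ N₄ (i₃₄ n≥))))
      where
      sδ = shrink (ε * ½) B (0<½* 0<ε) 0<B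
      sγ = shrink (ε * ½) C (0<½* 0<ε) 0<C
      yN = cy (proj₁ sδ) (proj₁ (proj₂ sδ))
      xN = cx (proj₁ sγ) (proj₁ (proj₂ sγ))
      N₃ = proj₁ yN
      N₄ = proj₁ xN
      N = (N₁ ℕ.⊔ N₂) ℕ.⊔ (N₃ ℕ.⊔ N₄)
      total : B * proj₁ sδ + C * proj₁ sγ ≡ ε
      total = trans (cong₂ _+_ (proj₂ (proj₂ sδ)) (proj₂ (proj₂ sγ))) (halves ε)
      i₁₂ : ∀ {n} → N ℕ.≤ n → N₁ ℕ.⊔ N₂ ℕ.≤ n
      i₁₂ = ℕₚ.m⊔n≤o⇒m≤o (N₁ ℕ.⊔ N₂) (N₃ ℕ.⊔ N₄)
      i₃₄ : ∀ {n} → N ℕ.≤ n → N₃ ℕ.⊔ N₄ ℕ.≤ n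
      i₃₄ = ℕₚ.m⊔n≤o⇒n≤o (N₁ ℕ.⊔ N₂) (N₃ ℕ.⊔ N₄)

open CauchyLemmas public

fromℚ : ℚ → ℝ
fromℚ q = mkℝ (λ _ → q) (const-cauchy q)

fromℕ : ℕ → ℝ
fromℕ n = fromℚ (+ n ℚ./ 1)

0ᴿ 1ᴿ : ℝ
0ᴿ = fromℚ 0ℚ
1ᴿ = fromℚ 1ℚ

infix  8 -ᴿ_
infixl 7 _*ᴿ_
infixl 6 _+ᴿ_ _-ᴿ_

_+ᴿ_ : ℝ → ℝ → ℝ
mkℝ x cx +ᴿ mkℝ y cy = mkℝ (λ n → x n ℚ.+ y n) (+-cauchy {x} {y} cx cy)

-ᴿ_ : ℝ → ℝ
-ᴿ mkℝ x cx = mkℝ (λ n → ℚ.- x n) (neg-cauchy {x} cx)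

_-ᴿ_ : ℝ → ℝ → ℝ
x -ᴿ y = x +ᴿ (-ᴿ y)

_*ᴿ_ : ℝ → ℝ → ℝ
mkℝ x cx *ᴿ mkℝ y cy = mkℝ (λ n → x n ℚ.* y n) (*-cauchy {x} {y} cx cy)

∣_∣ᴿ : ℝ → ℝ
∣ mkℝ x cx ∣ᴿ = mkℝ (λ n → ℚ.∣ x n ∣) (abs-cauchy {x} cx)

NonZeroᴿ : ℝ → Set
NonZeroᴿ x = 0ᴿ <ᴿ ∣ x ∣ᴿ

-- Total on ℚ so that a reciprocal of reals can be taken termwise; only
-- finitely many terms of a nonzero real can hit the junk value 0ℚ.
inv : ℚ → ℚ
inv q with q ℚₚ.≟ 0ℚ
... | yes _  = 0ℚ
... | no q≢0 = (ℚ.1/ q) {{ℚ.≢-nonZero q≢0}}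

module ReciprocalLemmas where

  inv-inverse : ∀ q → 0ℚ ℚ.< ℚ.∣ q ∣ → inv q * q ≡ 1ℚ
  inv-inverse q 0<∣q∣ with q ℚₚ.≟ 0ℚ
  ... | yes refl = contradiction 0<∣q∣ (ℚₚ.<-irrefl refl)
  ... | no q≢0   = ℚₚ.*-inverseˡ q {{ℚ.≢-nonZero q≢0}}

  inv-close : ∀ {p q δ ε} → 0ℚ ℚ.< δ → δ ℚ.≤ ℚ.∣ p ∣ → δ ℚ.≤ ℚ.∣ q ∣ →
    ℚ.∣ q - p ∣ ℚ.< δ * δ * ε → ℚ.∣ inv p - inv q ∣ ℚ.< ε
  inv-close {p} {q} {δ} {ε} 0<δ δ≤p δ≤q q~p = ℚₚ.*-cancelˡ-<-nonNeg (δ * δ)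
    {{ℚ.nonNegative (ℚₚ.<⇒≤ (0<* 0<δ 0<δ))}} (let open QR in begin-strict
    δ * δ * ℚ.∣ a - b ∣
      ≤⟨ ℚₚ.*-monoʳ-≤-nonNeg ℚ.∣ a - b ∣ {{ℚₚ.∣-∣-nonNeg (a - b)}}
           (*-mono-≤ (ℚₚ.<⇒≤ 0<δ) (ℚₚ.0≤∣p∣ q) δ≤p δ≤q) ⟩
    ℚ.∣ p ∣ * ℚ.∣ q ∣ * ℚ.∣ a - b ∣
      ≡⟨ cong (_* ℚ.∣ a - b ∣) (sym (ℚₚ.∣p*q∣≡∣p∣*∣q∣ p q)) ⟩
    ℚ.∣ p * q ∣ * ℚ.∣ a - b ∣
      ≡⟨ sym (ℚₚ.∣p*q∣≡∣p∣*∣q∣ (p * q) (a - b)) ⟩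
    ℚ.∣ p * q * (a - b) ∣
      ≡⟨ cong ℚ.∣_∣ (solve 4 (λ u v a b → u :* v :* (a :- b) := v :* (a :* u) :- u :* (b :* v)) refl
                       p q a b) ⟩
    ℚ.∣ q * (a * p) - p * (b * q) ∣
      ≡⟨ cong₂ (λ s t → ℚ.∣ q * s - p * t ∣)
           (inv-inverse p (ℚₚ.<-≤-trans 0<δ δ≤p)) (inv-inverse q (ℚₚ.<-≤-trans 0<δ δ≤q)) ⟩
    ℚ.∣ q * 1ℚ - p * 1ℚ ∣
      ≡⟨ cong₂ (λ s t → ℚ.∣ s - t ∣) (ℚₚ.*-identityʳ q) (ℚₚ.*-identityʳ p) ⟩
    ℚ.∣ q - p ∣
      <⟨ q~p ⟩
    δ * δ * ε ∎)
    where
    open +-*-Solver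
    a = inv p
    b = inv q

  inv-cauchy : ∀ {x} (cx : IsCauchy x) → NonZeroᴿ (mkℝ x cx) → IsCauchy (λ n → inv (x n))
  inv-cauchy {x} cx (δ , 0<δ , N₁ , δ≤′) ε 0<ε = N₁ ℕ.⊔ N₂ , λ m n m≥ n≥ →
    inv-close {x m} {x n} {δ} {ε} 0<δ
      (δ≤ m (ℕₚ.m⊔n≤o⇒m≤o N₁ N₂ m≥)) (δ≤ n (ℕₚ.m⊔n≤o⇒m≤o N₁ N₂ n≥))
      (proj₂ xN n m (ℕₚ.m⊔n≤o⇒n≤o N₁ N₂ n≥) (ℕₚ.m⊔n≤o⇒n≤o N₁ N₂ m≥))
    where
    xN = cx (δ * δ * ε) (0<* (0<* 0<δ 0<δ) 0<ε)
    N₂ = proj₁ xN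
    δ≤ : ∀ n → N₁ ℕ.≤ n → δ ℚ.≤ ℚ.∣ x n ∣
    δ≤ n n≥ = subst (ℚ._≤ ℚ.∣ x n ∣) (ℚₚ.+-identityˡ δ) (δ≤′ n n≥)

open ReciprocalLemmas public

1/ᴿ : (x : ℝ) → NonZeroᴿ x → ℝ
1/ᴿ (mkℝ x cx) x≢0 = mkℝ (λ n → inv (x n)) (inv-cauchy {x} cx x≢0)

divide : (x y : ℝ) → NonZeroᴿ y → ℝ
divide x y y≢0 = x *ᴿ 1/ᴿ y y≢0

infix 4 _⟶_

_⟶_ : (ℕ → ℝ) → ℝ → Set
a ⟶ l = ∀ ε → 0ᴿ <ᴿ ε → ∃[ N ] ∀ n → N ℕ.≤ n → ∣ a n -ᴿ l ∣ᴿ <ᴿ ε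

-- 1/(a+1) + 1/(a+2) + ⋯ + 1/(a+n)
recipSum : ℕ → ℕ → ℚ
recipSum a zero    = 0ℚ
recipSum a (suc n) = + 1 ℚ./ suc a ℚ.+ recipSum (suc a) n

-- The natural logarithm is log m = ∫₁ᵐ dt/t.  With k = suc i, cut [1 , m] into (m - 1)k pieces of length 1/k.  The
-- lower Riemann sum of 1/t is Σ (1/k)(1/(j/k)) = Σ 1/j over k < j ≤ mk.
logSeq : ℕ → ℕ → ℚ
logSeq m i = recipSum (suc i) ((m ℕ.∸ 1) ℕ.* suc i)

module LogLemmas where

  ι : ℕ → ℚ
  ι n = + n ℚ./ 1

  r : ℕ → ℚ
  r n = + 1 ℚ./ suc n

  r≃ : ∀ n → toℚᵘ (r n) ℚᵘ.≃ mkℚᵘ (+ 1) n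
  r≃ n = ℚₚ.toℚᵘ-fromℚᵘ (mkℚᵘ (+ 1) n)

  0<r : ∀ n → 0ℚ ℚ.< r n
  0<r n = ℚₚ.positive⁻¹ (r n) {{ℚₚ.normalize-pos 1 (suc n)}}

  r-anti : ∀ {m n} → m ℕ.≤ n → r n ℚ.≤ r m
  r-anti {m} {n} m≤n = ℚₚ.toℚᵘ-cancel-≤
    (ℚᵘₚ.≤-respʳ-≃ (ℚᵘₚ.≃-sym (r≃ m)) (ℚᵘₚ.≤-respˡ-≃ (ℚᵘₚ.≃-sym (r≃ n))
      (ℚᵘ.*≤* (subst₂ ℤ._≤_ (sym (ℤₚ.*-identityˡ (+ suc m))) (sym (ℤₚ.*-identityˡ (+ suc n)))
        (ℤ.+≤+ (ℕ.s≤s m≤n))))))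

  r-* : ∀ m n → r m * r n ≡ r (n ℕ.+ m ℕ.* suc n)
  r-* m n = ℚₚ.toℚᵘ-injective (ℚᵘₚ.≃-trans (ℚₚ.toℚᵘ-homo-* (r m) (r n))
    (ℚᵘₚ.≃-trans (ℚᵘₚ.*-cong (r≃ m) (r≃ n)) (ℚᵘₚ.≃-sym (r≃ (n ℕ.+ m ℕ.* suc n)))))

  ι-suc : ∀ n → ι (suc n) ≡ 1ℚ + ι n
  ι-suc n = ℚₚ.toℚᵘ-injective (ℚᵘₚ.≃-trans (ℚₚ.toℚᵘ-fromℚᵘ (mkℚᵘ (+ suc n) 0))
    (ℚᵘₚ.≃-trans (ℚᵘ.*≡* {mkℚᵘ (+ suc n) 0} {mkℚᵘ (+ 1) 0 ℚᵘ.+ mkℚᵘ (+ n) 0}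
      (cong (λ z → (+ 1 ℤ.+ z) ℤ.* + 1) (sym (ℤₚ.*-identityʳ (+ n)))))
    (ℚᵘₚ.≃-sym (ℚᵘₚ.≃-trans (ℚₚ.toℚᵘ-homo-+ 1ℚ (ι n))
      (ℚᵘₚ.+-cong (ℚᵘₚ.≃-refl {toℚᵘ 1ℚ}) (ℚₚ.toℚᵘ-fromℚᵘ (mkℚᵘ (+ n) 0)))))))

  ι*r : ∀ n → ι (suc n) * r n ≡ 1ℚ
  ι*r n = ℚₚ.toℚᵘ-injective (ℚᵘₚ.≃-trans (ℚₚ.toℚᵘ-homo-* (ι (suc n)) (r n))
    (ℚᵘₚ.≃-trans (ℚᵘₚ.*-cong (ℚₚ.toℚᵘ-fromℚᵘ (mkℚᵘ (+ suc n) 0)) (r≃ n))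
      (ℚᵘ.*≡* (cong +_ (trans (ℕₚ.*-identityʳ (suc n ℕ.* 1))
        (trans (ℕₚ.*-identityʳ (suc n))
        (sym (trans (ℕₚ.*-identityˡ (1 ℕ.* suc n)) (ℕₚ.*-identityˡ (suc n))))))))))

  ι*r*r : ∀ j l → ι (suc l) * r (l ℕ.+ j ℕ.* suc l) ≡ r j
  ι*r*r j l = begin
    ι (suc l) * r (l ℕ.+ j ℕ.* suc l)  ≡⟨ cong (ι (suc l) *_) (sym (r-* j l)) ⟩
    ι (suc l) * (r j * r l)
      ≡⟨ solve 3 (λ a b c → a :* (b :* c) := b :* (a :* c)) refl (ι (suc l)) (r j) (r l) ⟩
    r j * (ι (suc l) * r l)            ≡⟨ cong (r j *_) (ι*r l) ⟩
    r j * 1ℚ                           ≡⟨ ℚₚ.*-identityʳ (r j) ⟩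
    r j                                ∎
    where
    open ≡-Reasoning
    open +-*-Solver

  0≤ι : ∀ n → 0ℚ ℚ.≤ ι n
  0≤ι n = ℚₚ.nonNegative⁻¹ (ι n) {{ℚₚ.normalize-nonNeg n 1}}

  0≤recipSum : ∀ a n → 0ℚ ℚ.≤ recipSum a n
  0≤recipSum a zero    = ℚₚ.≤-refl
  0≤recipSum a (suc n) = ℚₚ.+-mono-≤ (ℚₚ.<⇒≤ (0<r a)) (0≤recipSum (suc a) n)

  recipSum-++ : ∀ a m n → recipSum a (m ℕ.+ n) ≡ recipSum a m + recipSum (a ℕ.+ m) n
  recipSum-++ a zero    n = trans (cong (λ b → recipSum b n) (sym (ℕₚ.+-identityʳ a)))
                                  (sym (ℚₚ.+-identityˡ _))
  recipSum-++ a (suc m) n = trans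
    (cong (λ s → r a + s) (trans (recipSum-++ (suc a) m n)
      (cong (λ b → recipSum (suc a) m + recipSum b n) (sym (ℕₚ.+-suc a m)))))
    (sym (ℚₚ.+-assoc (r a) (recipSum (suc a) m) (recipSum (a ℕ.+ suc m) n)))

  ι-suc-* : ∀ n q → ι (suc n) * q ≡ q + ι n * q
  ι-suc-* n q = trans (cong (_* q) (ι-suc n))
    (trans (ℚₚ.*-distribʳ-+ q 1ℚ (ι n)) (cong (λ z → z + ι n * q) (ℚₚ.*-identityˡ q)))

  recipSum-lower : ∀ a n b → a ℕ.+ n ℕ.≤ suc b → ι n * r b ℚ.≤ recipSum a n
  recipSum-lower a zero    b _   = ℚₚ.≤-reflexive (ℚₚ.*-zeroˡ (r b))
  recipSum-lower a (suc n) b a+n≤ = subst (ℚ._≤ r a + recipSum (suc a) n) (sym (ι-suc-* n (r b)))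
    (ℚₚ.+-mono-≤ (r-anti (ℕₚ.≤-trans (ℕₚ.m≤m+n a n) (ℕₚ.≤-pred le)))
                 (recipSum-lower (suc a) n b le))
    where
    le : suc a ℕ.+ n ℕ.≤ suc b
    le = subst (ℕ._≤ suc b) (ℕₚ.+-suc a n) a+n≤

  recipSum-upper : ∀ a n b → b ℕ.≤ a → recipSum a n ℚ.≤ ι n * r b
  recipSum-upper a zero    b _   = ℚₚ.≤-reflexive (sym (ℚₚ.*-zeroˡ (r b)))
  recipSum-upper a (suc n) b b≤a = subst (r a + recipSum (suc a) n ℚ.≤_) (sym (ι-suc-* n (r b)))
    (ℚₚ.+-mono-≤ (r-anti b≤a) (recipSum-upper (suc a) n b (ℕₚ.m≤n⇒m≤1+n b≤a)))

  refine-≥ : ∀ l j n → recipSum j n ℚ.≤ recipSum (j ℕ.* suc l) (n ℕ.* suc l)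
  refine-≥ l j zero    = ℚₚ.≤-refl
  refine-≥ l j (suc n) = subst (recipSum j (suc n) ℚ.≤_)
    (sym (recipSum-++ (j ℕ.* suc l) (suc l) (n ℕ.* suc l)))
    (ℚₚ.+-mono-≤
      (subst (ℚ._≤ recipSum (j ℕ.* suc l) (suc l)) (ι*r*r j l)
        (recipSum-lower (j ℕ.* suc l) (suc l) (l ℕ.+ j ℕ.* suc l)
          (ℕₚ.≤-reflexive (ℕₚ.+-comm (j ℕ.* suc l) (suc l)))))
      (subst (λ b → recipSum (suc j) n ℚ.≤ recipSum b (n ℕ.* suc l))
        (ℕₚ.+-comm (suc l) (j ℕ.* suc l)) (refine-≥ l (suc j) n)))

  refine-≤ : ∀ l j n → recipSum (suc j ℕ.* suc l) (n ℕ.* suc l) ℚ.≤ recipSum j n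
  refine-≤ l j zero    = ℚₚ.≤-refl
  refine-≤ l j (suc n) = subst (ℚ._≤ recipSum j (suc n))
    (sym (recipSum-++ (suc j ℕ.* suc l) (suc l) (n ℕ.* suc l)))
    (ℚₚ.+-mono-≤
      (subst (recipSum (suc j ℕ.* suc l) (suc l) ℚ.≤_) (ι*r*r j l)
        (recipSum-upper (suc j ℕ.* suc l) (suc l) (l ℕ.+ j ℕ.* suc l) (ℕₚ.n≤1+n _)))
      (subst (λ b → recipSum b (n ℕ.* suc l) ℚ.≤ recipSum (suc j) n)
        (ℕₚ.+-comm (suc l) (suc j ℕ.* suc l)) (refine-≤ l (suc j) n)))

  recipSum-shift : ∀ j n → recipSum j n ℚ.≤ recipSum (suc j) n + r j
  recipSum-shift j zero    = subst (0ℚ ℚ.≤_) (sym (ℚₚ.+-identityˡ (r j))) (ℚₚ.<⇒≤ (0<r j))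
  recipSum-shift j (suc n) = subst (r j + recipSum (suc j) n ℚ.≤_)
    (solve 3 (λ a b c → a :+ (b :+ c) := c :+ b :+ a) refl
      (r j) (recipSum (suc (suc j)) n) (r (suc j)))
    (ℚₚ.+-monoʳ-≤ (r j) (recipSum-shift (suc j) n))
    where open +-*-Solver

  logSeq-close : ∀ m i j → logSeq m i - logSeq m j ℚ.≤ r j
  logSeq-close m i j = ≤+⇒-≤ (let open QR in begin
    recipSum (suc i) (M ℕ.* suc i)                          ≤⟨ refine-≥ j (suc i) (M ℕ.* suc i) ⟩
    recipSum (suc i ℕ.* suc j) (M ℕ.* suc i ℕ.* suc j)
      ≡⟨ cong₂ recipSum (ℕₚ.*-comm (suc i) (suc j))
           (trans (ℕₚ.*-assoc M (suc i) (suc j))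
             (trans (cong (M ℕ.*_) (ℕₚ.*-comm (suc i) (suc j)))
                    (sym (ℕₚ.*-assoc M (suc j) (suc i))))) ⟩
    recipSum (suc j ℕ.* suc i) (M ℕ.* suc j ℕ.* suc i)      ≤⟨ refine-≤ i j (M ℕ.* suc j) ⟩
    recipSum j (M ℕ.* suc j)                                ≤⟨ recipSum-shift j (M ℕ.* suc j) ⟩
    logSeq m j + r j                                        ≡⟨ ℚₚ.+-comm (logSeq m j) (r j) ⟩
    r j + logSeq m j                                        ∎)
    where M = m ℕ.∸ 1

  archimedean : ∀ ε → 0ℚ ℚ.< ε → ∃[ N ] r N ℚ.< ε
  archimedean ε@(ℚ.mkℚ (+ zero) d c) 0<ε =
    contradiction (ℚ.positive 0<ε) λ ()
  archimedean (ℚ.mkℚ (ℤ.-[1+ n ]) d c) 0<ε =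
    contradiction (ℚ.positive 0<ε) λ ()
  archimedean (ℚ.mkℚ (+ suc n) d c) 0<ε = suc d , ℚₚ.toℚᵘ-cancel-<
    (ℚᵘₚ.<-respˡ-≃ (ℚᵘₚ.≃-sym (r≃ (suc d)))
      (ℚᵘ.*<* (subst (ℤ._< + suc n ℤ.* + suc (suc d)) (sym (ℤₚ.*-identityˡ (+ suc d)))
        (ℤ.+<+ (ℕₚ.m≤m+n (suc (suc d)) (n ℕ.* suc (suc d)))))))

  logSeq-cauchy : ∀ m → IsCauchy (logSeq m)
  logSeq-cauchy m ε 0<ε with archimedean ε 0<ε
  ... | N , rN<ε = N , λ i j i≥ j≥ → ℚₚ.≤-<-trans
    (∣∣≤ (ℚₚ.≤-trans (logSeq-close m i j) (r-anti j≥))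
         (subst (ℚ._≤ r N) (solve 2 (λ a b → b :- a := :- (a :- b)) refl (logSeq m i) (logSeq m j))
           (ℚₚ.≤-trans (logSeq-close m j i) (r-anti i≥))))
    rN<ε
    where open +-*-Solver

open LogLemmas public

-- Only meaningful for m ≥ 1; log 0 is junk, equal to 0.
log : ℕ → ℝ
log m = mkℝ (logSeq m) (logSeq-cauchy m)

n*logn≢0 : ∀ m → NonZeroᴿ (fromℕ (2 ℕ.+ m) *ᴿ log (2 ℕ.+ m))
n*logn≢0 m = ½ , ℚₚ.positive⁻¹ ½ , 0 , λ i _ →
  let open QR in begin
  0ℚ + ½                                   ≡⟨ ℚₚ.+-identityˡ ½ ⟩
  ½                                        ≡⟨ sym (ι*r*r 1 i) ⟩
  ι (suc i) * r (i ℕ.+ 1 ℕ.* suc i)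
    ≤⟨ recipSum-lower (suc i) (suc i) (i ℕ.+ 1 ℕ.* suc i)
         (ℕₚ.≤-reflexive (cong (suc i ℕ.+_) (sym (ℕₚ.*-identityˡ (suc i))))) ⟩
  recipSum (suc i) (suc i)                 ≡⟨ sym (ℚₚ.+-identityʳ _) ⟩
  recipSum (suc i) (suc i) + 0ℚ
    ≤⟨ ℚₚ.+-monoʳ-≤ (recipSum (suc i) (suc i)) (0≤recipSum (suc i ℕ.+ suc i) (m ℕ.* suc i)) ⟩
  recipSum (suc i) (suc i) + recipSum (suc i ℕ.+ suc i) (m ℕ.* suc i)
    ≡⟨ sym (recipSum-++ (suc i) (suc i) (m ℕ.* suc i)) ⟩
  logSeq (2 ℕ.+ m) i                       ≡⟨ sym (ℚₚ.+-identityʳ _) ⟩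
  logSeq (2 ℕ.+ m) i + 0ℚ
    ≤⟨ ℚₚ.+-monoʳ-≤ (logSeq (2 ℕ.+ m) i)
         (subst (ℚ._≤ ι (suc m) * logSeq (2 ℕ.+ m) i) (ℚₚ.*-zeroˡ 0ℚ)
           (*-mono-≤ ℚₚ.≤-refl (0≤recipSum (suc i) (suc m ℕ.* suc i)) (0≤ι (suc m))
             (0≤recipSum (suc i) (suc m ℕ.* suc i)))) ⟩
  logSeq (2 ℕ.+ m) i + ι (suc m) * logSeq (2 ℕ.+ m) i
    ≡⟨ sym (ι-suc-* (suc m) (logSeq (2 ℕ.+ m) i)) ⟩
  ι (2 ℕ.+ m) * logSeq (2 ℕ.+ m) i
    ≤⟨ p≤∣p∣ (ι (2 ℕ.+ m) * logSeq (2 ℕ.+ m) i) ⟩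
  ℚ.∣ ι (2 ℕ.+ m) * logSeq (2 ℕ.+ m) i ∣   ∎
  where
  p≤∣p∣ : ∀ p → p ℚ.≤ ℚ.∣ p ∣
  p≤∣p∣ p with ℚₚ.≤-total 0ℚ p
  ... | inj₁ 0≤p = ℚₚ.≤-reflexive (sym (ℚₚ.0≤p⇒∣p∣≡p 0≤p))
  ... | inj₂ p≤0 = ℚₚ.≤-trans p≤0 (ℚₚ.0≤∣p∣ p)

record SimpleGraph (V : Set) : Set₁ where
  field
    Adj    : Rel V 0ℓ
    symm   : Symmetric Adj
    irrefl : Irreflexive _≡_ Adj

open SimpleGraph public

infix 4 _≅_

record _≅_ {V W : Set} (G : SimpleGraph V) (H : SimpleGraph W) : Set where
  field
    vertices : V ↔ W
    edges    : ∀ u v → Adj G u v ⇔ Adj H (Inverse.to vertices u) (Inverse.to vertices v)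

-- An interval of any kind (open, closed, half-open, bounded or not):
-- a nonempty order-convex subset of the line.
record Interval : Set₁ where
  field
    Contains : ℝ → Set
    nonempty : ∃[ x ] Contains x
    convex   : ∀ {x y z} → x ≤ᴿ y → y ≤ᴿ z → Contains x → Contains z → Contains y

open Interval public

Meets : Rel Interval 0ℓ
Meets A B = ∃[ x ] Contains A x × Contains B x

intersectionGraph : {J : Set} → (J → Interval) → SimpleGraph J
intersectionGraph A = record
  { Adj    = λ i j → i ≢ j × Meets (A i) (A j)
  ; symm   = λ { (i≢j , x , x∈i , x∈j) → i≢j ∘ sym , x , x∈j , x∈i }
  ; irrefl = λ { i≡j (i≢j , _) → i≢j i≡j }
  }

IsIntervalGraph : {V : Set} → SimpleGraph V → Set₁
IsIntervalGraph G = Σ[ J ∈ Set ] Σ[ A ∈ (J → Interval) ] G ≅ intersectionGraph A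

-- A finite graph is understood to have decidable adjacency, which is
-- automatic classically.
record IntervalGraph (n : ℕ) : Set₁ where
  field
    graph           : SimpleGraph (Fin n)
    adj?            : Decidable (Adj graph)
    isIntervalGraph : IsIntervalGraph graph

open IntervalGraph public

≅-refl : {V : Set} {G : SimpleGraph V} → G ≅ G
≅-refl = record { vertices = ↔-refl ; edges = λ _ _ → mk⇔ (λ e → e) (λ e → e) }

≅-sym : {V W : Set} {G : SimpleGraph V} {H : SimpleGraph W} → G ≅ H → H ≅ G
≅-sym {G = G} {H} f = record
  { vertices = ↔-sym φ
  ; edges    = λ u v → mk⇔
      (λ e → Equivalence.from (_≅_.edges f (from u) (from v))
        (subst₂ (Adj H) (sym (to∘from u)) (sym (to∘from v)) e))
      (λ e → subst₂ (Adj H) (to∘from u) (to∘from v)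
        (Equivalence.to (_≅_.edges f (from u) (from v)) e))
  }
  where
  φ = _≅_.vertices f
  from = Inverse.from φ
  to∘from = Inverse.strictlyInverseˡ φ

≅-trans : {U V W : Set} {F : SimpleGraph U} {G : SimpleGraph V} {H : SimpleGraph W} →
  F ≅ G → G ≅ H → F ≅ H
≅-trans f g = record
  { vertices = ↔-trans (_≅_.vertices f) (_≅_.vertices g)
  ; edges    = λ u v → mk⇔
      (Equivalence.to (_≅_.edges g _ _) ∘ Equivalence.to (_≅_.edges f u v))
      (Equivalence.from (_≅_.edges f u v) ∘ Equivalence.from (_≅_.edges g _ _))
  }

UnlabeledIntervalGraphs : ℕ → Setoid (lsuc 0ℓ) 0ℓ
UnlabeledIntervalGraphs n = record
  { Carrier       = IntervalGraph n
  ; _≈_           = λ G H → graph G ≅ graph H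
  ; isEquivalence = record { refl = ≅-refl ; sym = ≅-sym ; trans = ≅-trans }
  }

HasSize : Setoid (lsuc 0ℓ) 0ℓ → ℕ → Set₁
HasSize S k = Bijection (setoid (Fin k)) S

hasSize-unique : ∀ {S k l} → HasSize S k → HasSize S l → k ≡ l
hasSize-unique {S} f g = ℕₚ.≤-antisym (≤ f g) (≤ g f)
  where
  ≤ : ∀ {k l} → HasSize S k → HasSize S l → k ℕ.≤ l
  ≤ f g = Finₚ.injective⇒≤ {f = λ i → proj₁ (G.strictlySurjective (F.to i))} λ {i} {j} e →
    F.injective (S.trans (S.sym (proj₂ (G.strictlySurjective (F.to i))))
      (S.trans (G.cong e) (proj₂ (G.strictlySurjective (F.to j)))))
    where
    module F = Bijection f
    module G = Bijection g
    module S = Setoid S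

{-# OPTIONS --safe #-}

-- Upper bound: ordering the vertices by left endpoint, the neighbours of a vertex among its
-- successors form an initial segment of them, so the graph is determined up to isomorphism by a
-- function Fin n → Fin n, and I n ≤ n ^ n.
--
-- Lower bound: take 2k points and m = n - 2k intervals containing the middle of them.  Such an
-- interval is determined by the points it contains, so there are k ^ 2m of these labeled graphs.  A
-- labeled graph is determined by its class and a map Fin n → Fin n onto the representative, whence
-- k ^ 2m ≤ I n * n ^ n.  With k = n / q this gives n ^ (n q) ≤ I n ^ q * n ^ (5 n) for large n, so
-- 1 - 5 / q is asymptotically a lower bound of log (I n) / (n log n).

module Submission where

open import Data.Nat.Base as ℕ using (ℕ; zero; suc; _+_; _*_; _∸_; _^_; _⊔_; _≤_; _<_; s≤s; z≤n; NonZero; _/_; _%_)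
import Data.Nat.DivMod as ℕₚ
import Data.Nat.Properties as ℕₚ
open import Data.Nat.Tactic.RingSolver using (solve-∀)
import Data.Integer.Base as ℤ
open import Data.Rational.Base as ℚ using (ℚ; 0ℚ; 1ℚ; ½)
import Data.Rational.Properties as ℚₚ
open import Data.Rational.Solver using (module +-*-Solver)
open import Data.Fin.Base as Fin using (Fin; zero; suc; toℕ; punchIn; finToFun; funToFin; _↑ˡ_; _↑ʳ_; splitAt; combine)
import Data.Fin.Properties as Finₚ
open import Data.Fin.Permutation using (Permutation′; insert; insert-punchIn; _⟨$⟩ʳ_)
open import Data.Product using (Σ-syntax; ∃-syntax; _×_; _,_; proj₁; proj₂)
open import Data.Sum.Base using (_⊎_; inj₁; inj₂; [_,_]′)
open import Effect.Monad using (RawMonad)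
open import Function.Base using (_∘_; id)
open import Function.Bundles using (_↔_; _⇔_; mk⇔; mk↔ₛ′; Inverse; Injection; Equivalence; Bijection)
open import Function.Properties.Inverse using (↔-refl; ↔⇒↣)
open import Level using (0ℓ) renaming (suc to lsuc)
open import Relation.Binary.Bundles using (Setoid)
open import Relation.Binary.Core using (Rel)
open import Relation.Binary.Definitions using (Transitive; Total; tri<; tri≈; tri>)
open import Relation.Binary.PropositionalEquality
  using (_≡_; _≢_; _≗_; refl; sym; trans; cong; cong₂; subst; subst₂; module ≡-Reasoning)
open import Relation.Nullary using (Dec; yes; no; ¬_; ¬?; contradiction; _×-dec_; _⊎-dec_; _→-dec_)
open import Relation.Nullary.Decidable using (map′; decidable-stable)
open import Relation.Nullary.Negation using (¬¬-Monad; ¬¬-map)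
open import Defs

-- The order of the reals

≤ᴿ-refl : ∀ x → x ≤ᴿ x
≤ᴿ-refl x ε 0<ε = 0 , λ n _ →
  subst (ℚ._≤ seq x n ℚ.+ ε) (ℚₚ.+-identityʳ (seq x n)) (ℚₚ.+-monoʳ-≤ (seq x n) (ℚₚ.<⇒≤ 0<ε))

≤ᴿ-trans : ∀ {x y z} → x ≤ᴿ y → y ≤ᴿ z → x ≤ᴿ z
≤ᴿ-trans {x} {y} {z} x≤y y≤z ε 0<ε with x≤y (ε ℚ.* ½) (0<½* 0<ε) | y≤z (ε ℚ.* ½) (0<½* 0<ε)
... | M , p | N , q = M ⊔ N , λ n n≥ → let open ℚₚ.≤-Reasoning in begin
  seq x n                                ≤⟨ p n (ℕₚ.m⊔n≤o⇒m≤o M N n≥) ⟩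
  seq y n ℚ.+ ε ℚ.* ½                    ≤⟨ ℚₚ.+-monoˡ-≤ (ε ℚ.* ½) (q n (ℕₚ.m⊔n≤o⇒n≤o M N n≥)) ⟩
  seq z n ℚ.+ ε ℚ.* ½ ℚ.+ ε ℚ.* ½        ≡⟨ ℚₚ.+-assoc (seq z n) (ε ℚ.* ½) (ε ℚ.* ½) ⟩
  seq z n ℚ.+ (ε ℚ.* ½ ℚ.+ ε ℚ.* ½)      ≡⟨ cong (seq z n ℚ.+_) (halves ε) ⟩
  seq z n ℚ.+ ε                          ∎

p≤∣p∣ : ∀ p → p ℚ.≤ ℚ.∣ p ∣
p≤∣p∣ p with ℚₚ.≤-total 0ℚ p
... | inj₁ 0≤p = ℚₚ.≤-reflexive (sym (ℚₚ.0≤p⇒∣p∣≡p 0≤p))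
... | inj₂ p≤0 = ℚₚ.≤-trans p≤0 (ℚₚ.0≤∣p∣ p)

-≤⇒≤+ : ∀ {p q r} → p ℚ.- q ℚ.≤ r → p ℚ.≤ q ℚ.+ r
-≤⇒≤+ {p} {q} {r} p-q≤r = subst (ℚ._≤ q ℚ.+ r)
  (solve 2 (λ p q → q :+ (p :- q) := p) refl p q) (ℚₚ.+-monoʳ-≤ q p-q≤r)
  where open +-*-Solver

∣-∣<⇒≤+ : ∀ {p q d} → ℚ.∣ p ℚ.- q ∣ ℚ.< d → p ℚ.≤ q ℚ.+ d
∣-∣<⇒≤+ {p} {q} close = -≤⇒≤+ {p} {q} (ℚₚ.≤-trans (p≤∣p∣ (p ℚ.- q)) (ℚₚ.<⇒≤ close))

-- The sign of a real is undecidable, but one rational term can be tested. Past the Cauchy index for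
-- `ε / 2` the tail stays within `ε / 2` of `z N`; if `z N` exceeds `ε / 2`, no later term can be
-- negative.
cauchy-dichotomy : ∀ {z} → IsCauchy z → ∀ ε → 0ℚ ℚ.< ε →
  (∃[ N ] ∀ n → N ≤ n → z n ℚ.≤ ε) ⊎ (∃[ N ] ∀ n → N ≤ n → 0ℚ ℚ.≤ z n)
cauchy-dichotomy {z} cz ε 0<ε with cz (ε ℚ.* ½) (0<½* 0<ε)
... | N , close with z N ℚₚ.≤? ε ℚ.* ½
... | yes small = inj₁ (N , λ n n≥ → let open ℚₚ.≤-Reasoning in begin
  z n                        ≤⟨ ∣-∣<⇒≤+ {z n} {z N} (close n N n≥ ℕₚ.≤-refl) ⟩
  z N ℚ.+ ε ℚ.* ½            ≤⟨ ℚₚ.+-monoˡ-≤ (ε ℚ.* ½) small ⟩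
  ε ℚ.* ½ ℚ.+ ε ℚ.* ½        ≡⟨ halves ε ⟩
  ε                          ∎)
... | no large = inj₂ (N , λ n n≥ → ℚₚ.≮⇒≥ λ negative → large (let open ℚₚ.≤-Reasoning in begin
  z N                        ≤⟨ ∣-∣<⇒≤+ {z N} {z n} (close N n ℕₚ.≤-refl n≥) ⟩
  z n ℚ.+ ε ℚ.* ½            ≤⟨ ℚₚ.+-monoˡ-≤ (ε ℚ.* ½) (ℚₚ.<⇒≤ negative) ⟩
  0ℚ ℚ.+ ε ℚ.* ½             ≡⟨ ℚₚ.+-identityˡ (ε ℚ.* ½) ⟩
  ε ℚ.* ½                    ∎))

-- The dichotomy is applied to `y - x`, separately for each `ε`. Its first case is the estimate
-- wanted for that `ε`; its second would give `x ≤ᴿ y` for every tolerance at once.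
≰ᴿ⇒≥ᴿ : ∀ x y → ¬ (x ≤ᴿ y) → y ≤ᴿ x
≰ᴿ⇒≥ᴿ x y x≰y ε 0<ε with cauchy-dichotomy (cauchy (y -ᴿ x)) ε 0<ε
... | inj₁ (N , small) = N , λ n n≥ → -≤⇒≤+ {seq y n} {seq x n} (small n n≥)
... | inj₂ (N , 0≤y-x) = contradiction (λ δ 0<δ → N , λ n n≥ → ℚₚ.≤-trans
  (subst₂ ℚ._≤_ (ℚₚ.+-identityˡ (seq x n))
     (solve 2 (λ x y → (y :+ :- x) :+ x := y) refl (seq x n) (seq y n))
     (ℚₚ.+-monoˡ-≤ (seq x n) (0≤y-x n n≥)))
  (subst (ℚ._≤ seq y n ℚ.+ δ) (ℚₚ.+-identityʳ (seq y n)) (ℚₚ.+-monoʳ-≤ (seq y n) (ℚₚ.<⇒≤ 0<δ))))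
  x≰y
  where open +-*-Solver

¬¬-≤ᴿ-total : ∀ x y → ¬ ¬ (x ≤ᴿ y ⊎ y ≤ᴿ x)
¬¬-≤ᴿ-total x y neither = neither (inj₂ (≰ᴿ⇒≥ᴿ x y (neither ∘ inj₁)))

ι-+ : ∀ m n → ι (m + n) ≡ ι m ℚ.+ ι n
ι-+ zero    n = sym (ℚₚ.+-identityˡ (ι n))
ι-+ (suc m) n = begin
  ι (suc (m + n))               ≡⟨ ι-suc (m + n) ⟩
  1ℚ ℚ.+ ι (m + n)              ≡⟨ cong (1ℚ ℚ.+_) (ι-+ m n) ⟩
  1ℚ ℚ.+ (ι m ℚ.+ ι n)          ≡⟨ sym (ℚₚ.+-assoc 1ℚ (ι m) (ι n)) ⟩
  1ℚ ℚ.+ ι m ℚ.+ ι n            ≡⟨ cong (ℚ._+ ι n) (sym (ι-suc m)) ⟩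
  ι (suc m) ℚ.+ ι n             ∎
  where open ≡-Reasoning

ι-mono-≤ : ∀ {m n} → m ≤ n → ι m ℚ.≤ ι n
ι-mono-≤ {m} m≤n with ℕₚ.m≤n⇒∃[o]m+o≡n m≤n
... | o , refl = let open ℚₚ.≤-Reasoning in begin
  ι m              ≡⟨ sym (ℚₚ.+-identityʳ (ι m)) ⟩
  ι m ℚ.+ 0ℚ       ≤⟨ ℚₚ.+-monoʳ-≤ (ι m) (0≤ι o) ⟩
  ι m ℚ.+ ι o      ≡⟨ sym (ι-+ m o) ⟩
  ι (m + o)        ∎

fromℕ-mono-≤ : ∀ {m n} → m ≤ n → fromℕ m ≤ᴿ fromℕ n
fromℕ-mono-≤ {m} {n} m≤n ε 0<ε = 0 , λ _ _ → ℚₚ.≤-trans (ι-mono-≤ m≤n)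
  (subst (ℚ._≤ ι n ℚ.+ ε) (ℚₚ.+-identityʳ (ι n)) (ℚₚ.+-monoʳ-≤ (ι n) (ℚₚ.<⇒≤ 0<ε)))

-- The tolerance ½ is smaller than the gap between distinct integers, so the approximate inequality
-- is already exact.
fromℕ-cancel-≤ : ∀ {m n} → fromℕ m ≤ᴿ fromℕ n → m ≤ n
fromℕ-cancel-≤ {m} {n} m≤n with m ℕₚ.≤? n | m≤n ½ (ℚₚ.positive⁻¹ ½)
... | yes p | _ = p
... | no ¬p | N , q = contradiction (ℚₚ.<-≤-trans bound (q N ℕₚ.≤-refl)) (ℚₚ.<-irrefl refl)
  where
  bound : ι n ℚ.+ ½ ℚ.< ι m
  bound = let open ℚₚ.≤-Reasoning in begin-strict
    ι n ℚ.+ ½      <⟨ ℚₚ.+-monoʳ-< (ι n) (ℚ.*<* (ℤ.+<+ (s≤s (s≤s z≤n)))) ⟩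
    ι n ℚ.+ 1ℚ     ≡⟨ ℚₚ.+-comm (ι n) 1ℚ ⟩
    1ℚ ℚ.+ ι n     ≡⟨ sym (ι-suc n) ⟩
    ι (suc n)      ≤⟨ ι-mono-≤ (ℕₚ.≰⇒> ¬p) ⟩
    ι m            ∎

-- Interval graphs from integer endpoints

closed : (a b : ℕ) → a ≤ b → Interval
closed a b a≤b = record
  { Contains = λ x → fromℕ a ≤ᴿ x × x ≤ᴿ fromℕ b
  ; nonempty = fromℕ a , ≤ᴿ-refl (fromℕ a) , fromℕ-mono-≤ a≤b
  ; convex   = λ {x} {y} {z} x≤y y≤z x∈ z∈ →
      ≤ᴿ-trans {fromℕ a} {x} {y} (proj₁ x∈) x≤y , ≤ᴿ-trans {y} {z} {fromℕ b} y≤z (proj₂ z∈)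
  }

-- The larger left endpoint is a common point. Conversely, a common real point links the integer
-- endpoints by transitivity, and `fromℕ-cancel-≤` returns to ℕ.
meets-closed : ∀ {a b c d} (a≤b : a ≤ b) (c≤d : c ≤ d) →
  (a ≤ d × c ≤ b) ⇔ Meets (closed a b a≤b) (closed c d c≤d)
meets-closed {a} {b} {c} {d} a≤b c≤d = mk⇔
  (λ (a≤d , c≤b) → fromℕ (a ⊔ c)
    , (fromℕ-mono-≤ (ℕₚ.m≤m⊔n a c) , fromℕ-mono-≤ (ℕₚ.⊔-lub a≤b c≤b))
    , (fromℕ-mono-≤ (ℕₚ.m≤n⊔m a c) , fromℕ-mono-≤ (ℕₚ.⊔-lub a≤d c≤d)))
  (λ (x , (a≤x , x≤b) , (c≤x , x≤d)) →
      fromℕ-cancel-≤ (≤ᴿ-trans {fromℕ a} {x} {fromℕ d} a≤x x≤d)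
    , fromℕ-cancel-≤ (≤ᴿ-trans {fromℕ c} {x} {fromℕ b} c≤x x≤b))

-- Adjacency is given by inequalities in ℕ instead of `Meets`, which makes it decidable.
fromEndpoints : ∀ {n} (a b : Fin n → ℕ) → (∀ i → a i ≤ b i) → IntervalGraph n
fromEndpoints a b a≤b = record
  { graph = record
    { Adj    = λ i j → i ≢ j × a i ≤ b j × a j ≤ b i
    ; symm   = λ (i≢j , p , q) → i≢j ∘ sym , q , p
    ; irrefl = λ i≡j (i≢j , _) → i≢j i≡j
    }
  ; adj? = λ i j → ¬? (i Finₚ.≟ j) ×-dec a i ℕₚ.≤? b j ×-dec a j ℕₚ.≤? b i
  ; isIntervalGraph = _ , (λ i → closed (a i) (b i) (a≤b i)) , record
    { vertices = ↔-refl
    ; edges    = λ i j → mk⇔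
        (λ (i≢j , m) → i≢j , Equivalence.to (meets-closed (a≤b i) (a≤b j)) m)
        (λ (i≢j , m) → i≢j , Equivalence.from (meets-closed (a≤b i) (a≤b j)) m)
    }
  }

-- Interval orderings

least : ∀ {n} {_≲_ : Rel (Fin n) 0ℓ} → Transitive _≲_ → Total _≲_ → Fin n →
  ∃[ m ] ∀ j → m ≲ j
least {suc zero} {_≲_} _ total _ = zero , λ { zero → [ id , id ]′ (total zero zero) }
least {suc (suc n)} {_≲_} ≲-trans total _
  with least {suc n} {λ i j → suc i ≲ suc j} ≲-trans (λ i j → total (suc i) (suc j)) zero
... | m , m≲ with total zero (suc m)
...   | inj₁ 0≲m = zero , λ { zero → [ id , id ]′ (total zero zero) ; (suc j) → ≲-trans 0≲m (m≲ j) }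
...   | inj₂ m≲0 = suc m , λ { zero → m≲0 ; (suc j) → m≲ j }

-- Selection sort: a least element `m` goes first, and `punchIn m` enumerates the others for the
-- recursive call.
sort : ∀ n {_≲_ : Rel (Fin n) 0ℓ} → Transitive _≲_ → Total _≲_ →
  Σ[ π ∈ Permutation′ n ] ∀ i j → i Fin.< j → (π ⟨$⟩ʳ i) ≲ (π ⟨$⟩ʳ j)
sort zero    _ _ = ↔-refl , λ ()
sort (suc n) {_≲_} ≲-trans total
  with least ≲-trans total zero
... | m , m≲
  with sort n {λ i j → punchIn m i ≲ punchIn m j} ≲-trans (λ i j → total (punchIn m i) (punchIn m j))
... | π , sorted = insert zero m π , λ
  { zero    j       _         → m≲ _
  ; (suc i) (suc j) (s≤s i<j) → subst₂ _≲_ (sym (insert-punchIn zero m π i))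
                                  (sym (insert-punchIn zero m π j)) (sorted i j i<j) }

IsIntervalOrdering : ∀ {n} → SimpleGraph (Fin n) → Permutation′ n → Set
IsIntervalOrdering G π = ∀ {i j k} → i Fin.< j → j Fin.< k →
  Adj G (π ⟨$⟩ʳ i) (π ⟨$⟩ʳ k) → Adj G (π ⟨$⟩ʳ i) (π ⟨$⟩ʳ j)

↔-injective : ∀ {A B : Set} (φ : A ↔ B) {x y} → Inverse.to φ x ≡ Inverse.to φ y → x ≡ y
↔-injective φ = Injection.injective (↔⇒↣ φ)

-- Sorting needs all comparisons simultaneously; double negation commutes with finite conjunctions.
¬¬-∀ : ∀ {n} {P : Fin n → Set} → (∀ i → ¬ ¬ P i) → ¬ ¬ (∀ i → P i)
¬¬-∀ = Finₚ.sequence (RawMonad.rawApplicative ¬¬-Monad)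

-- Sort the vertices u by the least of the finitely many chosen points of the interval of u.
-- The reals are totally ordered only up to double negation.
¬¬-intervalOrdering : ∀ {n} (G : IntervalGraph n) → ¬ ¬ (∃[ π ] IsIntervalOrdering (graph G) π)
¬¬-intervalOrdering {n} G with isIntervalGraph G
... | J , A , iso = ¬¬-map ordering
    (¬¬-∀ λ u → ¬¬-∀ λ v → ¬¬-∀ λ u′ → ¬¬-∀ λ v′ → ¬¬-≤ᴿ-total (point u v) (point u′ v′))
  where
  φ : Fin n → J
  φ = Inverse.to (_≅_.vertices iso)

  B : Fin n → Interval
  B u = A (φ u)

  -- An interval may be open or unbounded, so it need not have a left endpoint. A point shared with
  -- each neighbour, and an arbitrary point for each non-neighbour, retain enough of it.
  choose : ∀ u v → ∃[ x ] Contains (B u) x × (Adj (graph G) u v → Contains (B v) x)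
  choose u v with adj? G u v
  ... | yes u~v = let (_ , x , x∈u , x∈v) = Equivalence.to (_≅_.edges iso u v) u~v
                  in x , x∈u , λ _ → x∈v
  ... | no ¬u~v = let (x , x∈u) = nonempty (B u) in x , x∈u , λ u~v → contradiction u~v ¬u~v

  point : ∀ u v → ℝ
  point u v = proj₁ (choose u v)

  ordering : (∀ u v u′ v′ → point u v ≤ᴿ point u′ v′ ⊎ point u′ v′ ≤ᴿ point u v) →
    ∃[ π ] IsIntervalOrdering (graph G) π
  ordering total = π , λ {i} {j} {k} i<j j<k i~k →
    let u = π ⟨$⟩ʳ i ; v = π ⟨$⟩ʳ j ; w = π ⟨$⟩ʳ k in
    Equivalence.from (_≅_.edges iso u v)
      ( (λ φu≡φv → Finₚ.<⇒≢ i<j (↔-injective π (↔-injective (_≅_.vertices iso) φu≡φv)))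
      , left v
      -- `left u ≤ left v ≤ left w ≤ point w u`, and both ends of this chain lie in the interval of
      -- `u`, hence so does `left v`.
      , convex (B u) {left u} {left v} {point w u}
          (sorted i j i<j)
          (≤ᴿ-trans {left v} {left w} {point w u} (sorted j k j<k) (left≤ w u))
          (proj₁ (proj₂ (choose u _)))
          (proj₂ (proj₂ (choose w u)) (symm (graph G) i~k))
      , proj₁ (proj₂ (choose v _)))
    where
    leftmost : ∀ u → ∃[ v ] ∀ v′ → point u v ≤ᴿ point u v′
    leftmost u = least {_≲_ = λ v v′ → point u v ≤ᴿ point u v′}
      (λ {v₁} {v₂} {v₃} → ≤ᴿ-trans {point u v₁} {point u v₂} {point u v₃}) (λ v v′ → total u v u v′) u

    left : Fin n → ℝ
    left u = point u (proj₁ (leftmost u))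

    left≤ : ∀ u v → left u ≤ᴿ point u v
    left≤ u = proj₂ (leftmost u)

    sorting = sort n {λ u v → left u ≤ᴿ left v}
      (λ {u} {v} {w} → ≤ᴿ-trans {left u} {left v} {left w}) (λ u v → total u _ v _)
    π = proj₁ sorting
    sorted = proj₂ sorting

-- The maximum keeps the interval nonempty for every `f`, so each of the `n ^ n` functions encodes a
-- graph.
fromReach : ∀ {n} → (Fin n → Fin n) → IntervalGraph n
fromReach f = fromEndpoints toℕ (λ i → toℕ i ⊔ toℕ (f i)) (λ i → ℕₚ.m≤m⊔n (toℕ i) (toℕ (f i)))

greatest : ∀ {n} {P : Fin n → Set} → (∀ i → Dec (P i)) → ∀ i → P i →
  ∃[ m ] P m × (∀ j → P j → j Fin.≤ m)
greatest {suc n} P? i p with Finₚ.any? (P? ∘ suc)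
... | yes (j , pj) = let (m , pm , ≤m) = greatest (P? ∘ suc) j pj
                     in suc m , pm , λ { zero _ → z≤n ; (suc k) pk → s≤s (≤m k pk) }
greatest {suc n} P? zero    p | no none = zero , p , λ
  { zero _ → z≤n ; (suc k) pk → contradiction (k , pk) none }
greatest {suc n} P? (suc i) p | no none = contradiction (i , p) none

-- Let `f i` be the last neighbour of position `i`, or `i` itself if no neighbour comes later. The
-- ordering property makes every position strictly between `i` and `f i` a neighbour too.
fromReach-≅ : ∀ {n} (G : IntervalGraph n) π → IsIntervalOrdering (graph G) π →
  ∃[ f ] graph (fromReach f) ≅ graph G
fromReach-≅ {n} G π ordered = f , record
  { vertices = π
  ; edges    = λ i j → edge i j
  }
  where
  _~_ : Rel (Fin n) 0ℓ
  i ~ j = Adj (graph G) (π ⟨$⟩ʳ i) (π ⟨$⟩ʳ j)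

  -- Admitting `i` itself gives the search a starting witness and ensures `i ≤ f i`.
  reach : ∀ i → ∃[ m ] (i ≡ m ⊎ i ~ m) × (∀ j → (i ≡ j ⊎ i ~ j) → j Fin.≤ m)
  reach i = greatest (λ j → (i Finₚ.≟ j) ⊎-dec adj? G _ _) i (inj₁ refl)

  f : Fin n → Fin n
  f i = proj₁ (reach i)

  reached : ∀ {i j} → i Fin.< j → toℕ j ≤ toℕ i ⊔ toℕ (f i) → i ~ j
  reached {i} {j} i<j j≤ with reach i
  ... | m , i⋯m , ≤m with subst (toℕ j ≤_) (ℕₚ.m≤n⇒m⊔n≡n (≤m i (inj₁ refl))) j≤ | i⋯m
  ...   | j≤m | inj₁ refl = contradiction j≤m (ℕₚ.<⇒≱ i<j)
  ...   | j≤m | inj₂ i~m with ℕₚ.m≤n⇒m<n∨m≡n j≤m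
  ...     | inj₁ j<m = ordered i<j j<m i~m
  ...     | inj₂ j≡m = subst (i ~_) (sym (Finₚ.toℕ-injective j≡m)) i~m

  edge : ∀ i j → Adj (graph (fromReach f)) i j ⇔ i ~ j
  edge i j = mk⇔ there back
    where
    there : Adj (graph (fromReach f)) i j → i ~ j
    there (i≢j , i≤ , j≤) with Finₚ.<-cmp i j
    ... | tri< i<j _ _ = reached i<j j≤
    ... | tri≈ _ i≡j _ = contradiction i≡j i≢j
    ... | tri> _ _ j<i = symm (graph G) (reached j<i i≤)
    back : i ~ j → Adj (graph (fromReach f)) i j
    back i~j = (λ { refl → irrefl (graph G) refl i~j })
      , ℕₚ.≤-trans (proj₂ (proj₂ (reach j)) i (inj₂ (symm (graph G) i~j))) (ℕₚ.m≤n⊔m (toℕ j) _)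
      , ℕₚ.≤-trans (proj₂ (proj₂ (reach i)) j (inj₂ i~j)) (ℕₚ.m≤n⊔m (toℕ i) _)

-- Finiteness of the number of isomorphism classes

-- Isomorphism unpacked into finitely many decidable conditions on a map and its inverse.
_≅[_,_]_ : ∀ {n} → IntervalGraph n → (Fin n → Fin n) → (Fin n → Fin n) → IntervalGraph n → Set
G ≅[ to , from ] H = (∀ u → from (to u) ≡ u) × (∀ v → to (from v) ≡ v)
  × (∀ u v → (Adj (graph G) u v → Adj (graph H) (to u) (to v))
           × (Adj (graph H) (to u) (to v) → Adj (graph G) u v))

≅[,]-dec : ∀ {n} (G H : IntervalGraph n) to from → Dec (G ≅[ to , from ] H)
≅[,]-dec G H to from =
  Finₚ.all? (λ u → from (to u) Finₚ.≟ u) ×-dec Finₚ.all? (λ v → to (from v) Finₚ.≟ v)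
  ×-dec Finₚ.all? λ u → Finₚ.all? λ v → (adj? G u v →-dec adj? H (to u) (to v))
                                  ×-dec (adj? H (to u) (to v) →-dec adj? G u v)

≅[,]-cong : ∀ {n} (G H : IntervalGraph n) {to from to′ from′} →
  to ≗ to′ → from ≗ from′ → G ≅[ to , from ] H → G ≅[ to′ , from′ ] H
≅[,]-cong G H {to} {from} {to′} {from′} t f (l , r , e) =
    (λ u → trans (cong from′ (sym (t u))) (trans (sym (f (to u))) (l u)))
  , (λ v → trans (cong to′ (sym (f v))) (trans (sym (t (from v))) (r v)))
  , (λ u v → subst₂ (λ x y → (Adj (graph G) u v → Adj (graph H) x y)
                           × (Adj (graph H) x y → Adj (graph G) u v)) (t u) (t v) (e u v))

-- All pairs of maps are searched through their codes in `Fin (n ^ n)`. Decoding recovers a map only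
-- pointwise, hence the transport by `≅[,]-cong`.
≅-dec : ∀ {n} (G H : IntervalGraph n) → Dec (graph G ≅ graph H)
≅-dec {n} G H = map′
  (λ (c , d , l , r , e) → record
    { vertices = mk↔ₛ′ (finToFun c) (finToFun d) r l
    ; edges    = λ u v → mk⇔ (proj₁ (e u v)) (proj₂ (e u v)) })
  (λ iso → let to = Inverse.to (_≅_.vertices iso) ; from = Inverse.from (_≅_.vertices iso) in
    funToFin to , funToFin from , ≅[,]-cong G H
      (λ u → sym (Finₚ.finToFun-funToFin to u)) (λ v → sym (Finₚ.finToFun-funToFin from v))
      ( Inverse.strictlyInverseʳ (_≅_.vertices iso) , Inverse.strictlyInverseˡ (_≅_.vertices iso)
      , λ u v → Equivalence.to (_≅_.edges iso u v) , Equivalence.from (_≅_.edges iso u v)))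
  (Finₚ.any? λ (c : Fin (n ^ n)) → Finₚ.any? λ (d : Fin (n ^ n)) →
    ≅[,]-dec G H (finToFun c) (finToFun d))

module _ (S : Setoid (lsuc 0ℓ) 0ℓ) where
  open Setoid S using (_≈_) renaming (Carrier to C; refl to ≈-refl; sym to ≈-sym; trans to ≈-trans)

  -- The tail is thinned out first; index zero is then added only if no chosen representative is
  -- equivalent to it.
  representatives : ∀ m (f : Fin m → C) → (∀ i j → Dec (f i ≈ f j)) →
    ∃[ k ] Σ[ h ∈ (Fin k → Fin m) ]
      (∀ {i j} → f (h i) ≈ f (h j) → i ≡ j) × (∀ i → ∃[ j ] f (h j) ≈ f i)
  representatives zero    f f? = 0 , id , (λ { {()} }) , λ ()
  representatives (suc m) f f? with representatives m (f ∘ suc) (λ i j → f? (suc i) (suc j))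
  ... | k , h , h-inj , h-cover with Finₚ.any? (λ j → f? (suc (h j)) zero)
  ...   | yes old = k , suc ∘ h , h-inj , λ { zero → old ; (suc i) → h-cover i }
  ...   | no  new = suc k , h′ , (λ {i} {j} → h′-inj {i} {j}) , λ
    { zero    → zero , ≈-refl
    ; (suc i) → let (j , e) = h-cover i in suc j , e }
    where
    h′ : Fin (suc k) → Fin (suc m)
    h′ zero    = zero
    h′ (suc j) = suc (h j)
    h′-inj : ∀ {i j} → f (h′ i) ≈ f (h′ j) → i ≡ j
    h′-inj {zero}  {zero}  _ = refl
    h′-inj {zero}  {suc j} e = contradiction (j , ≈-sym e) new
    h′-inj {suc i} {zero}  e = contradiction (i , e) new
    h′-inj {suc i} {suc j} e = cong suc (h-inj e)

  hasSize-covered : ∀ m (f : Fin m → C) → (∀ i j → Dec (f i ≈ f j)) → (∀ y → ∃[ i ] f i ≈ y) →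
    ∃[ k ] HasSize S k × k ≤ m
  hasSize-covered m f f? f-cover with representatives m f f?
  ... | k , h , h-inj , h-cover = k
    , record
      { to        = f ∘ h
      ; cong      = λ { refl → ≈-refl }
      ; bijective = h-inj , λ y → let (i , fi≈y) = f-cover y ; (j , e) = h-cover i in
          j , λ { refl → ≈-trans e fi≈y }
      }
    , Finₚ.injective⇒≤ {f = h} λ {i} {j} e → h-inj (subst (λ l → f (h i) ≈ f l) e ≈-refl)

unlabeledIntervalGraphs-finite : ∀ n → ∃[ k ] HasSize (UnlabeledIntervalGraphs n) k × k ≤ n ^ n
unlabeledIntervalGraphs-finite n = hasSize-covered (UnlabeledIntervalGraphs n) (n ^ n)
  (fromReach ∘ finToFun′) (λ i j → ≅-dec (fromReach (finToFun′ i)) (fromReach (finToFun′ j)))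
  λ G → decidable-stable (Finₚ.any? λ c → ≅-dec (fromReach (finToFun′ c)) G)
    (¬¬-map (λ (π , ordered) → let (f , iso) = fromReach-≅ G π ordered in
        funToFin f , ≅-trans (fromReach-cong (Finₚ.finToFun-funToFin f)) iso)
      (¬¬-intervalOrdering G))
  where
  finToFun′ : Fin (n ^ n) → Fin n → Fin n
  finToFun′ = finToFun
  fromReach-cong : ∀ {f g : Fin n → Fin n} → f ≗ g → graph (fromReach f) ≅ graph (fromReach g)
  fromReach-cong {f} {g} f≗g = record
    { vertices = ↔-refl
    ; edges    = λ u v → mk⇔
        (λ (u≢v , u≤ , v≤) → u≢v , subst (λ z → toℕ u ≤ toℕ v ⊔ toℕ z) (f≗g v) u≤
                                 , subst (λ z → toℕ v ≤ toℕ u ⊔ toℕ z) (f≗g u) v≤)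
        (λ (u≢v , u≤ , v≤) → u≢v , subst (λ z → toℕ u ≤ toℕ v ⊔ toℕ z) (sym (f≗g v)) u≤
                                 , subst (λ z → toℕ v ≤ toℕ u ⊔ toℕ z) (sym (f≗g u)) v≤)
    }

-- A class together with an isomorphism to its representative determines a labeled graph.
labeled≤unlabeled : ∀ {n N M} → HasSize (UnlabeledIntervalGraphs n) N →
  (G : Fin M → IntervalGraph n) →
  (∀ {c d} → (∀ u v → Adj (graph (G c)) u v ⇔ Adj (graph (G d)) u v) → c ≡ d) →
  M ≤ N * n ^ n
labeled≤unlabeled {n} {N} {M} size G G-inj = Finₚ.injective⇒≤ {f = code} λ {c} {d} e →
  let (class≡ , iso≡) = Finₚ.combine-injective (class c) (funToFin (to c)) (class d) (funToFin (to d)) e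
  in G-inj λ u v → same c d class≡ (finToFun-cong iso≡) u v
  where
  module B = Bijection size
  class : Fin M → Fin N
  class c = proj₁ (B.strictlySurjective (G c))
  iso : ∀ c → graph (G c) ≅ graph (B.to (class c))
  iso c = ≅-sym (proj₂ (B.strictlySurjective (G c)))
  to : Fin M → Fin n → Fin n
  to c = Inverse.to (_≅_.vertices (iso c))
  code : Fin M → Fin (N * n ^ n)
  code c = combine (class c) (funToFin (to c))
  finToFun-cong : ∀ {f g : Fin n → Fin n} → funToFin f ≡ funToFin g → f ≗ g
  finToFun-cong {f} {g} e u = trans (sym (Finₚ.finToFun-funToFin f u))
    (trans (cong (λ z → finToFun z u) e) (Finₚ.finToFun-funToFin g u))
  same : ∀ c d → class c ≡ class d → to c ≗ to d → ∀ u v →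
    Adj (graph (G c)) u v ⇔ Adj (graph (G d)) u v
  same c d class≡ to≡ u v = mk⇔ (half c d class≡ to≡) (half d c (sym class≡) (sym ∘ to≡))
    where
    half : ∀ c d → class c ≡ class d → to c ≗ to d → Adj (graph (G c)) u v → Adj (graph (G d)) u v
    -- The edge goes to the common representative along `iso c` and comes back along `iso d`, which
    -- has the same vertex map.
    half c d class≡ to≡ u~v = Equivalence.from (_≅_.edges (iso d) u v)
      (subst (λ k → Adj (graph (B.to k)) (to d u) (to d v)) class≡
        (subst₂ (Adj (graph (B.to (class c)))) (to≡ u) (to≡ v)
          (Equivalence.to (_≅_.edges (iso c) u v) u~v)))

-- Points 0 , … , 2k - 1 as degenerate intervals, together with m intervals that start below k and
-- end at k or above, which are determined by the points they contain.
module _ (k m : ℕ) (h : Fin (m + m) → Fin k) where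

  -- A single `h` holds the left endpoints in its first half and the right ones in its second, so
  -- that `Fin (k ^ (m + m))` enumerates the families.
  lower upper : Fin (k + k) ⊎ Fin m → ℕ
  lower = [ toℕ , (λ w → toℕ (h (w ↑ˡ m))) ]′
  upper = [ toℕ , (λ w → k + toℕ (h (m ↑ʳ w))) ]′

  lower≤upper : ∀ v → lower v ≤ upper v
  lower≤upper (inj₁ p) = ℕₚ.≤-refl
  lower≤upper (inj₂ w) = ℕₚ.≤-trans (ℕₚ.<⇒≤ (Finₚ.toℕ<n (h (w ↑ˡ m)))) (ℕₚ.m≤m+n k _)

  spanning : IntervalGraph (k + k + m)
  spanning = fromEndpoints (lower ∘ splitAt (k + k)) (upper ∘ splitAt (k + k))
    (lower≤upper ∘ splitAt (k + k))

spanning-lookup : ∀ {k m} h u v → u ≢ v →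
  Adj (graph (spanning k m h)) (Fin.join (k + k) m u) (Fin.join (k + k) m v) ⇔
  (lower k m h u ≤ upper k m h v × lower k m h v ≤ upper k m h u)
spanning-lookup {k} {m} h u v u≢v = mk⇔
  (λ (_ , p , q) → subst₂ P (Finₚ.splitAt-join (k + k) m u) (Finₚ.splitAt-join (k + k) m v) (p , q))
  (λ pq → (λ e → u≢v (trans (sym (Finₚ.splitAt-join (k + k) m u))
                       (trans (cong (splitAt (k + k)) e) (Finₚ.splitAt-join (k + k) m v))))
        , subst₂ P (sym (Finₚ.splitAt-join (k + k) m u)) (sym (Finₚ.splitAt-join (k + k) m v)) pq)
  where
  P : Rel (Fin (k + k) ⊎ Fin m) 0ℓ
  P u v = lower k m h u ≤ upper k m h v × lower k m h v ≤ upper k m h u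

-- Adjacency to a point vertex means containing that point, and both endpoints of the interval `w`
-- under `g` are among the points. The interval under `h` therefore contains them as well.
spanning-contains : ∀ {k m} g h →
  (∀ u v → Adj (graph (spanning k m g)) u v → Adj (graph (spanning k m h)) u v) →
  ∀ w → lower k m h (inj₂ w) ≤ lower k m g (inj₂ w) × upper k m g (inj₂ w) ≤ upper k m h (inj₂ w)
spanning-contains {k} {m} g h g⇒h w =
    proj₁ (inside lo<k+k (ℕₚ.≤-refl , lower≤upper k m g (inj₂ w)))
  , proj₂ (inside (ℕₚ.+-monoʳ-< k (Finₚ.toℕ<n (g (m ↑ʳ w)))) (lower≤upper k m g (inj₂ w) , ℕₚ.≤-refl))
  where
  lo<k+k : lower k m g (inj₂ w) < k + k
  lo<k+k = ℕₚ.<-≤-trans (Finₚ.toℕ<n (g (w ↑ˡ m))) (ℕₚ.m≤m+n k k)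
  inside : ∀ {p} → p < k + k →
    lower k m g (inj₂ w) ≤ p × p ≤ upper k m g (inj₂ w) →
    lower k m h (inj₂ w) ≤ p × p ≤ upper k m h (inj₂ w)
  inside {p} p<k+k = subst
    (λ q → (lower k m g (inj₂ w) ≤ q × q ≤ upper k m g (inj₂ w)) →
           (lower k m h (inj₂ w) ≤ q × q ≤ upper k m h (inj₂ w)))
    (Finₚ.toℕ-fromℕ< p<k+k)
    λ pq → Equivalence.to (spanning-lookup h (inj₂ w) (inj₁ (Fin.fromℕ< p<k+k)) λ ())
      (g⇒h _ _ (Equivalence.from (spanning-lookup g (inj₂ w) (inj₁ (Fin.fromℕ< p<k+k)) λ ()) pq))

spanning-injective : ∀ {k m} g h →
  (∀ u v → Adj (graph (spanning k m g)) u v ⇔ Adj (graph (spanning k m h)) u v) → g ≗ h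
spanning-injective {k} {m} g h g⇔h x =
  subst (λ y → g y ≡ h y) (Finₚ.join-splitAt m m x) (equal (splitAt m x))
  where
  ⊆ = spanning-contains {k} {m} g h (λ u v → Equivalence.to (g⇔h u v))
  ⊇ = spanning-contains {k} {m} h g (λ u v → Equivalence.from (g⇔h u v))
  equal : ∀ y → g (Fin.join m m y) ≡ h (Fin.join m m y)
  equal (inj₁ w) = Finₚ.toℕ-injective (ℕₚ.≤-antisym (proj₁ (⊇ w)) (proj₁ (⊆ w)))
  equal (inj₂ w) = Finₚ.toℕ-injective (ℕₚ.+-cancelˡ-≡ k _ _ (ℕₚ.≤-antisym (proj₂ (⊆ w)) (proj₂ (⊇ w))))

spanning-count : ∀ {N} k m → HasSize (UnlabeledIntervalGraphs (k + k + m)) N →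
  k ^ (m + m) ≤ N * (k + k + m) ^ (k + k + m)
spanning-count k m size = labeled≤unlabeled {M = k ^ (m + m)} size (spanning k m ∘ finToFun) λ {c} {d} same →
  trans (sym (Finₚ.funToFin-finToFin {m + m} c))
    (trans (funToFin-cong (spanning-injective {k} {m} (finToFun c) (finToFun d) same))
      (Finₚ.funToFin-finToFin {m + m} d))
  where
  funToFin-cong : ∀ {m n} {f g : Fin m → Fin n} → f ≗ g → funToFin f ≡ funToFin g
  funToFin-cong {zero}  _   = refl
  funToFin-cong {suc m} f≗g = cong₂ combine (f≗g zero) (funToFin-cong (f≗g ∘ suc))

-- Asymptotics in the natural numbers

^-distribʳ-* : ∀ a b t → (a * b) ^ t ≡ a ^ t * b ^ t
^-distribʳ-* a b zero    = refl
^-distribʳ-* a b (suc t) = trans (cong (a * b *_) (^-distribʳ-* a b t)) (interchange a b (a ^ t) (b ^ t))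
  where
  interchange : ∀ a b x y → a * b * (x * y) ≡ a * x * (b * y)
  interchange = solve-∀

-- Substitute n ≤ k Q in the count of spanning families, and absorb Q using Q ^ 2q ≤ n.
spanning-bound : ∀ {I} n k m q Q .{{_ : NonZero n}} .{{_ : NonZero Q}} → k + k + m ≡ n → n ≤ k * Q → k * q ≤ n →
  Q ^ (q + q) ≤ n → k ^ (m + m) ≤ I * n ^ n → n ^ (n * q) ≤ I ^ q * n ^ (5 * n)
spanning-bound {I} n k m q Q 2k+m≡n n≤kQ kq≤n Q^2q≤n count = begin
  n ^ (n * q)                                          ≡⟨ ℕₚ.^-*-assoc n n q ⟨
  (n ^ n) ^ q                                          ≤⟨ ℕₚ.^-monoˡ-≤ q one ⟩
  (I * Q ^ (n + n) * n ^ (4 * k)) ^ q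
    ≡⟨ trans (^-distribʳ-* (I * Q ^ (n + n)) (n ^ (4 * k)) q)
             (cong (_* (n ^ (4 * k)) ^ q) (^-distribʳ-* I (Q ^ (n + n)) q)) ⟩
  I ^ q * (Q ^ (n + n)) ^ q * (n ^ (4 * k)) ^ q
    ≤⟨ ℕₚ.*-mono-≤ (ℕₚ.*-monoʳ-≤ (I ^ q) Q-part) n-part ⟩
  I ^ q * n ^ n * n ^ (4 * n)
    ≡⟨ trans (ℕₚ.*-assoc (I ^ q) (n ^ n) (n ^ (4 * n)))
             (cong (I ^ q *_) (sym (ℕₚ.^-distribˡ-+-* n n (4 * n)))) ⟩
  I ^ q * n ^ (5 * n)                                  ∎
  where
  open ℕₚ.≤-Reasoning
  m≤n : m ≤ n
  m≤n = subst (m ≤_) 2k+m≡n (ℕₚ.m≤n+m m (k + k))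
  exponents : ∀ k m → (k + k + m) + (k + k + m) ≡ (m + m) + 4 * k
  exponents = solve-∀
  regroup : ∀ a b c d → a * b * c * d ≡ a * c * d * b
  regroup = solve-∀
  swap : ∀ n q → (n + n) * q ≡ (q + q) * n
  swap = solve-∀
  -- Both sides are multiplied by `n ^ n`, because `2n = 2m + 4k` then exposes the exponent `2m` of
  -- the count.
  one : n ^ n ≤ I * Q ^ (n + n) * n ^ (4 * k)
  one = ℕₚ.*-cancelʳ-≤ _ _ (n ^ n) {{ℕₚ.m^n≢0 n n}} (begin
    n ^ n * n ^ n                                      ≡⟨ ℕₚ.^-distribˡ-+-* n n n ⟨
    n ^ (n + n)
      ≡⟨ cong (n ^_) (trans (cong₂ _+_ (sym 2k+m≡n) (sym 2k+m≡n)) (exponents k m)) ⟩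
    n ^ (m + m + 4 * k)                                ≡⟨ ℕₚ.^-distribˡ-+-* n (m + m) (4 * k) ⟩
    n ^ (m + m) * n ^ (4 * k)
      ≤⟨ ℕₚ.*-monoˡ-≤ (n ^ (4 * k)) (ℕₚ.^-monoˡ-≤ (m + m) n≤kQ) ⟩
    (k * Q) ^ (m + m) * n ^ (4 * k)
      ≡⟨ cong (_* n ^ (4 * k)) (^-distribʳ-* k Q (m + m)) ⟩
    k ^ (m + m) * Q ^ (m + m) * n ^ (4 * k)
      ≤⟨ ℕₚ.*-monoˡ-≤ (n ^ (4 * k)) (ℕₚ.*-mono-≤ count (ℕₚ.^-monoʳ-≤ Q (ℕₚ.+-mono-≤ m≤n m≤n))) ⟩
    I * n ^ n * Q ^ (n + n) * n ^ (4 * k)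
      ≡⟨ regroup I (n ^ n) (Q ^ (n + n)) (n ^ (4 * k)) ⟩
    I * Q ^ (n + n) * n ^ (4 * k) * n ^ n              ∎)
  Q-part : (Q ^ (n + n)) ^ q ≤ n ^ n
  Q-part = begin
    (Q ^ (n + n)) ^ q      ≡⟨ ℕₚ.^-*-assoc Q (n + n) q ⟩
    Q ^ ((n + n) * q)      ≡⟨ cong (Q ^_) (swap n q) ⟩
    Q ^ ((q + q) * n)      ≡⟨ ℕₚ.^-*-assoc Q (q + q) n ⟨
    (Q ^ (q + q)) ^ n      ≤⟨ ℕₚ.^-monoˡ-≤ n Q^2q≤n ⟩
    n ^ n                  ∎
  n-part : (n ^ (4 * k)) ^ q ≤ n ^ (4 * n)
  n-part = begin
    (n ^ (4 * k)) ^ q      ≡⟨ ℕₚ.^-*-assoc n (4 * k) q ⟩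
    n ^ (4 * k * q)        ≡⟨ cong (n ^_) (ℕₚ.*-assoc 4 k q) ⟩
    n ^ (4 * (k * q))      ≤⟨ ℕₚ.^-monoʳ-≤ n (ℕₚ.*-monoʳ-≤ 4 kq≤n) ⟩
    n ^ (4 * n)            ∎

-- With `k = n / q`, the remainder is at most `q ≤ k * q`, which gives `n ≤ k * Q` for `Q = 2q`.
-- Having `q ≥ 2` leaves room for the `2k` points.
lower-bound : ∀ p → ∃[ N ] ∀ {n I} → N ≤ n → HasSize (UnlabeledIntervalGraphs n) I →
  let q = 2 + p in n ^ (n * q) ≤ I ^ q * n ^ (5 * n)
lower-bound p = Q ^ (q + q) , bound
  where
  q = 2 + p
  Q = q + q
  bound : ∀ {n I} → Q ^ (q + q) ≤ n → HasSize (UnlabeledIntervalGraphs n) I →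
    n ^ (n * q) ≤ I ^ q * n ^ (5 * n)
  bound {n} {I} N≤n size = spanning-bound {I} n k m q Q {{ℕ.>-nonZero 0<n}} 2k+m≡n n≤kQ kq≤n N≤n
    (subst (λ n → k ^ (m + m) ≤ I * n ^ n) 2k+m≡n
      (spanning-count k m (subst (λ n → HasSize (UnlabeledIntervalGraphs n) I) (sym 2k+m≡n) size)))
    where
    open ℕₚ.≤-Reasoning
    q≤n : q ≤ n
    q≤n = begin
      q                  ≤⟨ ℕₚ.m≤m+n q q ⟩
      Q                  ≡⟨ ℕₚ.^-identityʳ Q ⟨
      Q ^ 1              ≤⟨ ℕₚ.^-monoʳ-≤ Q {1} {q + q} (s≤s z≤n) ⟩
      Q ^ (q + q)        ≤⟨ N≤n ⟩
      n                  ∎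
    0<n : 0 < n
    0<n = ℕₚ.<-≤-trans (s≤s z≤n) q≤n
    k = n / q
    m = n ∸ (k + k)
    kq≤n : k * q ≤ n
    kq≤n = ℕₚ.m/n*n≤m n q
    2k+m≡n : k + k + m ≡ n
    2k+m≡n = ℕₚ.m+[n∸m]≡n (begin
      k + k        ≡⟨ cong (k +_) (ℕₚ.+-identityʳ k) ⟨
      2 * k        ≡⟨ ℕₚ.*-comm 2 k ⟩
      k * 2        ≤⟨ ℕₚ.*-monoʳ-≤ k {2} {q} (s≤s (s≤s z≤n)) ⟩
      k * q        ≤⟨ kq≤n ⟩
      n            ∎)
    n≤kQ : n ≤ k * Q
    n≤kQ = begin
      n                    ≡⟨ ℕₚ.m≡m%n+[m/n]*n n q ⟩
      n % q + k * q        ≤⟨ ℕₚ.+-monoˡ-≤ (k * q) (ℕₚ.<⇒≤ (ℕₚ.m%n<n n q)) ⟩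
      q + k * q            ≡⟨ cong (_+ k * q) (ℕₚ.*-identityˡ q) ⟨
      1 * q + k * q        ≤⟨ ℕₚ.+-monoˡ-≤ (k * q) (ℕₚ.*-monoˡ-≤ q (ℕₚ.m≥n⇒m/n>0 q≤n)) ⟩
      k * q + k * q        ≡⟨ ℕₚ.*-distribˡ-+ k q q ⟨
      k * Q                ∎

-- The logarithm

recipSum-mono-≤ : ∀ a {m n} → m ≤ n → recipSum a m ℚ.≤ recipSum a n
recipSum-mono-≤ a {m} m≤n with ℕₚ.m≤n⇒∃[o]m+o≡n m≤n
... | o , refl = subst₂ ℚ._≤_ (ℚₚ.+-identityʳ _) (sym (recipSum-++ a m o))
                   (ℚₚ.+-monoʳ-≤ (recipSum a m) (0≤recipSum (a + m) o))

logSeq-mono-≤ : ∀ {m n} i → m ≤ n → logSeq m i ℚ.≤ logSeq n i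
logSeq-mono-≤ i m≤n = recipSum-mono-≤ (suc i) (ℕₚ.*-monoˡ-≤ (suc i) (ℕₚ.∸-monoˡ-≤ 1 m≤n))

-- The logarithm of b is the integral of 1/t over [a , ab].
logSeq-* : ∀ a b i → let j = i + a * suc i in
  logSeq (suc a * suc b) i ≡ logSeq (suc a) i ℚ.+ logSeq (suc b) j
logSeq-* a b i = trans (cong (recipSum (suc i)) (split a b i))
  (recipSum-++ (suc i) (a * suc i) (b * (suc a * suc i)))
  where
  split : ∀ a b i → (b + a * suc b) * suc i ≡ a * suc i + b * (suc a * suc i)
  split = solve-∀

-- `logSeq-*` is exact but evaluates the second factor on a finer subdivision; returning to index
-- `i` costs at most `r i`.
logSeq-*-≤ : ∀ a b i .{{_ : NonZero a}} .{{_ : NonZero b}} →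
  logSeq (a * b) i ℚ.≤ logSeq a i ℚ.+ (logSeq b i ℚ.+ r i)
logSeq-*-≤ (suc a) (suc b) i = subst (ℚ._≤ logSeq (suc a) i ℚ.+ (logSeq (suc b) i ℚ.+ r i))
  (sym (logSeq-* a b i))
  (ℚₚ.+-monoʳ-≤ (logSeq (suc a) i) (-≤⇒≤+ (logSeq-close (suc b) (i + a * suc i) i)))

logSeq-*-≥ : ∀ a b i .{{_ : NonZero a}} .{{_ : NonZero b}} →
  logSeq a i ℚ.+ logSeq b i ℚ.≤ logSeq (a * b) i ℚ.+ r i
logSeq-*-≥ (suc a) (suc b) i = let j = i + a * suc i ; open ℚₚ.≤-Reasoning in begin
  logSeq (suc a) i ℚ.+ logSeq (suc b) i
    ≤⟨ ℚₚ.+-monoʳ-≤ (logSeq (suc a) i) (-≤⇒≤+ (logSeq-close (suc b) i j)) ⟩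
  logSeq (suc a) i ℚ.+ (logSeq (suc b) j ℚ.+ r j)
    ≤⟨ ℚₚ.+-monoʳ-≤ (logSeq (suc a) i) (ℚₚ.+-monoʳ-≤ (logSeq (suc b) j) (r-anti (ℕₚ.m≤m+n i _))) ⟩
  logSeq (suc a) i ℚ.+ (logSeq (suc b) j ℚ.+ r i)
    ≡⟨ ℚₚ.+-assoc (logSeq (suc a) i) (logSeq (suc b) j) (r i) ⟨
  logSeq (suc a) i ℚ.+ logSeq (suc b) j ℚ.+ r i
    ≡⟨ cong (ℚ._+ r i) (sym (logSeq-* a b i)) ⟩
  logSeq (suc a * suc b) i ℚ.+ r i        ∎

logSeq-^-≤ : ∀ a t i .{{_ : NonZero a}} → logSeq (a ^ t) i ℚ.≤ ι t ℚ.* (logSeq a i ℚ.+ r i)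
logSeq-^-≤ a zero    i = ℚₚ.≤-reflexive (sym (ℚₚ.*-zeroˡ (logSeq a i ℚ.+ r i)))
logSeq-^-≤ a (suc t) i {{a≢0}} = let open ℚₚ.≤-Reasoning in begin
  logSeq (a * a ^ t) i                                 ≤⟨ logSeq-*-≤ a (a ^ t) i {{a≢0}} {{ℕₚ.m^n≢0 a t}} ⟩
  logSeq a i ℚ.+ (logSeq (a ^ t) i ℚ.+ r i)
    ≡⟨ solve 3 (λ x y z → x :+ (y :+ z) := (x :+ z) :+ y) refl (logSeq a i) (logSeq (a ^ t) i) (r i) ⟩
  logSeq a i ℚ.+ r i ℚ.+ logSeq (a ^ t) i
    ≤⟨ ℚₚ.+-monoʳ-≤ (logSeq a i ℚ.+ r i) (logSeq-^-≤ a t i) ⟩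
  logSeq a i ℚ.+ r i ℚ.+ ι t ℚ.* (logSeq a i ℚ.+ r i)  ≡⟨ ι-suc-* t (logSeq a i ℚ.+ r i) ⟨
  ι (suc t) ℚ.* (logSeq a i ℚ.+ r i)                   ∎
  where open +-*-Solver

logSeq-^-≥ : ∀ a t i .{{_ : NonZero a}} → ι t ℚ.* logSeq a i ℚ.≤ logSeq (a ^ t) i ℚ.+ ι t ℚ.* r i
logSeq-^-≥ a zero    i = ℚₚ.≤-reflexive (trans (ℚₚ.*-zeroˡ (logSeq a i))
  (sym (trans (ℚₚ.+-identityˡ _) (ℚₚ.*-zeroˡ (r i)))))
logSeq-^-≥ a (suc t) i {{a≢0}} = let open ℚₚ.≤-Reasoning in begin
  ι (suc t) ℚ.* logSeq a i                              ≡⟨ ι-suc-* t (logSeq a i) ⟩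
  logSeq a i ℚ.+ ι t ℚ.* logSeq a i
    ≤⟨ ℚₚ.+-monoʳ-≤ (logSeq a i) (logSeq-^-≥ a t i) ⟩
  logSeq a i ℚ.+ (logSeq (a ^ t) i ℚ.+ ι t ℚ.* r i)
    ≡⟨ ℚₚ.+-assoc (logSeq a i) (logSeq (a ^ t) i) (ι t ℚ.* r i) ⟨
  logSeq a i ℚ.+ logSeq (a ^ t) i ℚ.+ ι t ℚ.* r i
    ≤⟨ ℚₚ.+-monoˡ-≤ (ι t ℚ.* r i) (logSeq-*-≥ a (a ^ t) i {{a≢0}} {{ℕₚ.m^n≢0 a t}}) ⟩
  logSeq (a * a ^ t) i ℚ.+ r i ℚ.+ ι t ℚ.* r i
    ≡⟨ ℚₚ.+-assoc (logSeq (a * a ^ t) i) (r i) (ι t ℚ.* r i) ⟩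
  logSeq (a * a ^ t) i ℚ.+ (r i ℚ.+ ι t ℚ.* r i)
    ≡⟨ cong (logSeq (a * a ^ t) i ℚ.+_) (ι-suc-* t (r i)) ⟨
  logSeq (a * a ^ t) i ℚ.+ ι (suc t) ℚ.* r i            ∎

ι-* : ∀ m n → ι (m * n) ≡ ι m ℚ.* ι n
ι-* zero    n = sym (ℚₚ.*-zeroˡ (ι n))
ι-* (suc m) n = trans (ι-+ n (m * n)) (trans (cong (ι n ℚ.+_) (ι-* m n)) (sym (ι-suc-* m (ι n))))

module _ (n I i : ℕ) .{{n≢0 : NonZero n}} where
  private
    L = logSeq n i
    D = ι n ℚ.* L

  log-upper : I ≤ n ^ n → logSeq I i ℚ.≤ D ℚ.+ ι n ℚ.* r i
  log-upper I≤ = let open ℚₚ.≤-Reasoning in begin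
    logSeq I i                  ≤⟨ logSeq-mono-≤ i I≤ ⟩
    logSeq (n ^ n) i            ≤⟨ logSeq-^-≤ n n i ⟩
    ι n ℚ.* (L ℚ.+ r i)         ≡⟨ ℚₚ.*-distribˡ-+ (ι n) L (r i) ⟩
    D ℚ.+ ι n ℚ.* r i           ∎

  log-lower : ∀ q → n ^ (n * suc q) ≤ I ^ suc q * n ^ (5 * n) →
    ι (suc q) ℚ.* D ℚ.≤
      ι (suc q) ℚ.* logSeq I i ℚ.+ ι 5 ℚ.* D ℚ.+ ι (suc q + 5 * n + 1 + n * suc q) ℚ.* r i
  log-lower q bound = let open ℚₚ.≤-Reasoning in begin
    ιq ℚ.* D
      ≡⟨ solve 3 (λ q n l → q :* (n :* l) := (n :* q) :* l) refl ιq (ι n) L ⟩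
    ι n ℚ.* ιq ℚ.* L
      ≡⟨ cong (ℚ._* L) (ι-* n (suc q)) ⟨
    ι (n * suc q) ℚ.* L
      ≤⟨ logSeq-^-≥ n (n * suc q) i ⟩
    logSeq (n ^ (n * suc q)) i ℚ.+ ι (n * suc q) ℚ.* r i
      ≤⟨ ℚₚ.+-monoˡ-≤ (ι (n * suc q) ℚ.* r i) (logSeq-mono-≤ i bound) ⟩
    logSeq (I ^ suc q * n ^ (5 * n)) i ℚ.+ ι (n * suc q) ℚ.* r i
      ≤⟨ ℚₚ.+-monoˡ-≤ (ι (n * suc q) ℚ.* r i) (logSeq-*-≤ (I ^ suc q) (n ^ (5 * n)) i
           {{ℕₚ.m^n≢0 I (suc q) {{I≢0}}}} {{ℕₚ.m^n≢0 n (5 * n)}}) ⟩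
    logSeq (I ^ suc q) i ℚ.+ (logSeq (n ^ (5 * n)) i ℚ.+ r i) ℚ.+ ι (n * suc q) ℚ.* r i
      ≤⟨ ℚₚ.+-monoˡ-≤ (ι (n * suc q) ℚ.* r i) (ℚₚ.+-mono-≤ (logSeq-^-≤ I (suc q) i {{I≢0}})
           (ℚₚ.+-monoˡ-≤ (r i) (logSeq-^-≤ n (5 * n) i))) ⟩
    ιq ℚ.* (logSeq I i ℚ.+ r i) ℚ.+ (ι (5 * n) ℚ.* (L ℚ.+ r i) ℚ.+ r i) ℚ.+ ι (n * suc q) ℚ.* r i
      ≡⟨ solve 6 (λ q x f l r nq → q :* (x :+ r) :+ (f :* (l :+ r) :+ r) :+ nq :* r
                     := q :* x :+ f :* l :+ (q :+ f :+ con 1ℚ :+ nq) :* r)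
           refl ιq (logSeq I i) (ι (5 * n)) L (r i) (ι (n * suc q)) ⟩
    ιq ℚ.* logSeq I i ℚ.+ ι (5 * n) ℚ.* L ℚ.+ (ιq ℚ.+ ι (5 * n) ℚ.+ ι 1 ℚ.+ ι (n * suc q)) ℚ.* r i
      ≡⟨ cong₂ (λ x y → ιq ℚ.* logSeq I i ℚ.+ x ℚ.+ y ℚ.* r i)
           (trans (cong (ℚ._* L) (ι-* 5 n)) (ℚₚ.*-assoc (ι 5) (ι n) L))
           (sym (trans (ι-+ (suc q + 5 * n + 1) (n * suc q)) (cong (ℚ._+ ι (n * suc q))
             (trans (ι-+ (suc q + 5 * n) 1) (cong (ℚ._+ ι 1) (ι-+ (suc q) (5 * n))))))) ⟩
    ιq ℚ.* logSeq I i ℚ.+ ι 5 ℚ.* D ℚ.+ ι (suc q + 5 * n + 1 + n * suc q) ℚ.* r i      ∎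
    where
    open +-*-Solver
    ιq = ι (suc q)
    -- The product rule excludes the junk value `log 0`. For `I = 0` the right side of `bound`
    -- vanishes while the left side is positive.
    I≢0 : NonZero I
    I≢0 = ℕ.≢-nonZero λ { refl →
      ℕ.≢-nonZero⁻¹ (n ^ (n * suc q)) {{ℕₚ.m^n≢0 n (n * suc q)}} (ℕₚ.n≤0⇒n≡0 bound) }

-- Limits

-- Multiplying by the positive `D` reduces the claim to a bound of `η D` on the distance from `x` to
-- `D`.
divide-close : ∀ x D η → 0ℚ ℚ.< D → x ℚ.≤ D ℚ.+ η ℚ.* D → D ℚ.≤ x ℚ.+ η ℚ.* D →
  ℚ.∣ x ℚ.* inv D ℚ.- 1ℚ ∣ ℚ.≤ η
divide-close x D η 0<D x≤ D≤ = ℚₚ.*-cancelʳ-≤-pos D {{ℚ.positive 0<D}} (let open ℚₚ.≤-Reasoning in begin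
  ℚ.∣ ρ ∣ ℚ.* D
    ≡⟨ cong (ℚ.∣ ρ ∣ ℚ.*_) ∣D∣≡D ⟨
  ℚ.∣ ρ ∣ ℚ.* ℚ.∣ D ∣
    ≡⟨ ℚₚ.∣p*q∣≡∣p∣*∣q∣ ρ D ⟨
  ℚ.∣ ρ ℚ.* D ∣
    ≡⟨ cong ℚ.∣_∣ ρD ⟩
  ℚ.∣ x ℚ.- D ∣
    ≤⟨ ∣∣≤ (≤+⇒-≤ (subst (x ℚ.≤_) (ℚₚ.+-comm D (η ℚ.* D)) x≤))
           (subst (ℚ._≤ η ℚ.* D) (solve 2 (λ x d → d :- x := :- (x :- d)) refl x D)
             (≤+⇒-≤ (subst (D ℚ.≤_) (ℚₚ.+-comm x (η ℚ.* D)) D≤))) ⟩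
  η ℚ.* D                  ∎)
  where
  open +-*-Solver
  ρ = x ℚ.* inv D ℚ.- 1ℚ
  ∣D∣≡D : ℚ.∣ D ∣ ≡ D
  ∣D∣≡D = ℚₚ.0≤p⇒∣p∣≡p (ℚₚ.<⇒≤ 0<D)
  ρD : ρ ℚ.* D ≡ x ℚ.- D
  ρD = trans (solve 3 (λ x y d → (x :* y :- con 1ℚ) :* d := x :* (y :* d) :- d) refl x (inv D) D)
    (cong (ℚ._- D) (trans (cong (x ℚ.*_) (inv-inverse D (subst (0ℚ ℚ.<_) (sym ∣D∣≡D) 0<D)))
      (ℚₚ.*-identityʳ x)))

-- The discretization error `c` is at most one further `D`, whence 6 = 5 + 1; then `6 D ≤ Q η D`,
-- and `Q` cancels.
absorb : ∀ Q x D η c → 0ℚ ℚ.< Q → ½ ℚ.≤ D → c ℚ.≤ ½ → ι 6 ℚ.≤ Q ℚ.* η →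
  Q ℚ.* D ℚ.≤ Q ℚ.* x ℚ.+ ι 5 ℚ.* D ℚ.+ c → D ℚ.≤ x ℚ.+ η ℚ.* D
absorb Q x D η c 0<Q ½≤D c≤½ 6≤Qη QD≤ = ℚₚ.*-cancelˡ-≤-pos Q {{ℚ.positive 0<Q}} (let open ℚₚ.≤-Reasoning in begin
  Q ℚ.* D
    ≤⟨ QD≤ ⟩
  Q ℚ.* x ℚ.+ ι 5 ℚ.* D ℚ.+ c
    ≤⟨ ℚₚ.+-monoʳ-≤ (Q ℚ.* x ℚ.+ ι 5 ℚ.* D) (ℚₚ.≤-trans c≤½ ½≤D) ⟩
  Q ℚ.* x ℚ.+ ι 5 ℚ.* D ℚ.+ D
    ≡⟨ solve 3 (λ q x d → q :* x :+ con (ι 5) :* d :+ d := q :* x :+ con (ι 6) :* d) refl Q x D ⟩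
  Q ℚ.* x ℚ.+ ι 6 ℚ.* D
    ≤⟨ ℚₚ.+-monoʳ-≤ (Q ℚ.* x) (ℚₚ.*-monoʳ-≤-nonNeg D {{0≤D}} 6≤Qη) ⟩
  Q ℚ.* x ℚ.+ Q ℚ.* η ℚ.* D
    ≡⟨ solve 4 (λ q x e d → q :* x :+ q :* e :* d := q :* (x :+ e :* d)) refl Q x η D ⟩
  Q ℚ.* (x ℚ.+ η ℚ.* D)      ∎)
  where
  open +-*-Solver
  0≤D : ℚ.NonNegative D
  0≤D = ℚ.nonNegative (ℚₚ.≤-trans (ℚₚ.nonNegative⁻¹ ½) ½≤D)

ι*r-small : ∀ c ε → 0ℚ ℚ.< ε → ∃[ K ] ∀ i → K ≤ i → ι c ℚ.* r i ℚ.≤ ε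
-- Dividing by `suc c` also covers `c = 0`.
ι*r-small c ε 0<ε with shrink ε (ι (suc c)) 0<ε (ℚₚ.<-≤-trans (ℚₚ.positive⁻¹ 1ℚ) (ι-mono-≤ {1} {suc c} (s≤s z≤n)))
... | δ , 0<δ , ιδ≡ε with archimedean δ 0<δ
... | K , rK<δ = K , λ i K≤i → subst (ι c ℚ.* r i ℚ.≤_) ιδ≡ε
  (*-mono-≤ (0≤ι c) (ℚₚ.<⇒≤ 0<δ) (ι-mono-≤ (ℕₚ.n≤1+n c))
    (ℚₚ.≤-trans (r-anti K≤i) (ℚₚ.<⇒≤ rK<δ)))

archimedean-* : ∀ c η → 0ℚ ℚ.< c → 0ℚ ℚ.< η → ∃[ p ] c ℚ.≤ ι (2 + p) ℚ.* η
archimedean-* c η 0<c 0<η with shrink η c 0<η 0<c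
... | δ , 0<δ , cδ≡η with archimedean δ 0<δ
... | p , rp<δ = p , (let open ℚₚ.≤-Reasoning in begin
  c                                    ≡⟨ ℚₚ.*-identityʳ c ⟨
  c ℚ.* 1ℚ                             ≡⟨ cong (c ℚ.*_) (ι*r (suc p)) ⟨
  c ℚ.* (ι (2 + p) ℚ.* r (suc p))
    ≤⟨ ℚₚ.*-monoˡ-≤-nonNeg c {{ℚ.nonNegative (ℚₚ.<⇒≤ 0<c)}}
         (ℚₚ.*-monoˡ-≤-nonNeg (ι (2 + p)) {{ℚ.nonNegative (0≤ι (2 + p))}}
           (ℚₚ.≤-trans (r-anti (ℕₚ.n≤1+n p)) (ℚₚ.<⇒≤ rp<δ))) ⟩
  c ℚ.* (ι (2 + p) ℚ.* δ)
    ≡⟨ solve 3 (λ c q d → c :* (q :* d) := q :* (c :* d)) refl c (ι (2 + p)) δ ⟩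
  ι (2 + p) ℚ.* (c ℚ.* δ)              ≡⟨ cong (ι (2 + p) ℚ.*_) cδ≡η ⟩
  ι (2 + p) ℚ.* η                      ∎)
  where open +-*-Solver

-- `n*logn≢0` already carries this bound, with gap ½ and threshold 0; it remains to remove the
-- absolute value.
½≤n*logn : ∀ m i → ½ ℚ.≤ ι (2 + m) ℚ.* logSeq (2 + m) i
½≤n*logn m i = subst₂ ℚ._≤_ (ℚₚ.+-identityˡ ½)
  (ℚₚ.0≤p⇒∣p∣≡p {ι (2 + m) ℚ.* logSeq (2 + m) i} (subst (ℚ._≤ ι (2 + m) ℚ.* logSeq (2 + m) i) (ℚₚ.*-zeroˡ 0ℚ)
    (*-mono-≤ ℚₚ.≤-refl (0≤recipSum (suc i) ((1 + m) * suc i)) (0≤ι (2 + m))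
      (0≤recipSum (suc i) ((1 + m) * suc i)))))
  (proj₂ (proj₂ (proj₂ (n*logn≢0 m))) i z≤n)

log-ratio⟶1 : (I : ℕ → ℕ) → (∀ n → I n ≤ n ^ n) →
  (∀ p → ∃[ N ] ∀ {n} → N ≤ n → n ^ (n * (2 + p)) ≤ I n ^ (2 + p) * n ^ (5 * n)) →
  (λ m → divide (log (I (2 + m))) (fromℕ (2 + m) *ᴿ log (2 + m)) (n*logn≢0 m)) ⟶ 1ᴿ
log-ratio⟶1 I upper lower ε (e , 0<e , N₀ , e≤) = proj₁ (lower p) , λ m m≥ → limit m (ℕₚ.≤-trans m≥ (ℕₚ.m≤n+m m 2))
  where
  -- Half of `e` bounds the error of the ratio; the other half is the gap demanded by `_<ᴿ_`.
  η = e ℚ.* ½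
  0<η = 0<½* 0<e
  choice = archimedean-* (ι 6) η (ℚₚ.positive⁻¹ (ι 6)) 0<η
  p = proj₁ choice
  limit : ∀ m → proj₁ (lower p) ≤ 2 + m →
    ∣ divide (log (I (2 + m))) (fromℕ (2 + m) *ᴿ log (2 + m)) (n*logn≢0 m) -ᴿ 1ᴿ ∣ᴿ <ᴿ ε
  -- Here `n` is fixed and only the index `i` of the approximations grows, so the thresholds may
  -- depend on `n`. `N₀` gives `ε ≥ e`, `K₁` makes `n r i ≤ η / 2 ≤ η D` for the upper bound, and
  -- `K₂` makes `c r i ≤ ½` for `absorb`.
  limit m large = η , 0<η , N₀ ⊔ (K₁ ⊔ K₂) , λ i i≥ → let
      D = ι n ℚ.* logSeq n i
      i≥′ = ℕₚ.m⊔n≤o⇒n≤o N₀ (K₁ ⊔ K₂) i≥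
      ½≤D = ½≤n*logn m i
      open ℚₚ.≤-Reasoning
    in begin
    ℚ.∣ logSeq (I n) i ℚ.* inv D ℚ.- 1ℚ ∣ ℚ.+ η
      ≤⟨ ℚₚ.+-monoˡ-≤ η (divide-close (logSeq (I n) i) D η (ℚₚ.<-≤-trans (ℚₚ.positive⁻¹ ½) ½≤D)
           (ℚₚ.≤-trans (log-upper n (I n) i (upper n))
             (ℚₚ.+-monoʳ-≤ D (ℚₚ.≤-trans (small₁ i (ℕₚ.m⊔n≤o⇒m≤o K₁ K₂ i≥′))
               (ℚₚ.*-monoˡ-≤-nonNeg η {{ℚ.nonNegative (ℚₚ.<⇒≤ 0<η)}} ½≤D))))
           (absorb (ι (2 + p)) (logSeq (I n) i) D η (ι c ℚ.* r i)
             (ℚₚ.<-≤-trans (ℚₚ.positive⁻¹ 1ℚ) (ι-mono-≤ {1} {2 + p} (s≤s z≤n)))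
             ½≤D (small₂ i (ℕₚ.m⊔n≤o⇒n≤o K₁ K₂ i≥′)) (proj₂ choice)
             (log-lower n (I n) i (suc p) (proj₂ (lower p) large)))) ⟩
    η ℚ.+ η            ≡⟨ halves e ⟩
    e                  ≡⟨ ℚₚ.+-identityˡ e ⟨
    0ℚ ℚ.+ e           ≤⟨ e≤ i (ℕₚ.m⊔n≤o⇒m≤o N₀ (K₁ ⊔ K₂) i≥) ⟩
    seq ε i            ∎
    where
    n = 2 + m
    c = 2 + p + 5 * n + 1 + n * (2 + p)
    small₁′ = ι*r-small n (η ℚ.* ½) (0<½* 0<η)
    small₂′ = ι*r-small c ½ (ℚₚ.positive⁻¹ ½)
    K₁ = proj₁ small₁′
    K₂ = proj₁ small₂′
    small₁ = proj₂ small₁′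
    small₂ = proj₂ small₂′

mainTheorem2 : Σ[ I ∈ (ℕ → ℕ) ]
    (∀ n → HasSize (UnlabeledIntervalGraphs n) (I n))
    × ((λ m → divide (log (I (2 + m))) (fromℕ (2 + m) *ᴿ log (2 + m)) (n*logn≢0 m)) ⟶ 1ᴿ)
mainTheorem2 = I , size , log-ratio⟶1 I (λ n → proj₂ (proj₂ (unlabeledIntervalGraphs-finite n)))
  λ p → proj₁ (lower-bound p) , λ {n} n≥ → proj₂ (lower-bound p) n≥ (size n)
  where
  I : ℕ → ℕ
  I n = proj₁ (unlabeledIntervalGraphs-finite n)
  size : ∀ n → HasSize (UnlabeledIntervalGraphs n) (I n)
  size n = proj₁ (proj₂ (unlabeledIntervalGraphs-finite n))
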